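{- For every $r\ge1$ and every $T[n]\in\mathsf T_{\text{near-hook}}(n,r)$, the promotion period $\mathrm{pr}(T[n])$ divides $(2r-1)n-2r$.
   Context: For a tableau $T$ with distinct positive entries, $T[n]$ is obtained by placing above $T$ a top row consisting of all elements of $\{1,\dots,n\}$ not in $T$, in increasing order. Promotion $\mathcal P$ of a tableau with distinct entries $i_1<\dots<i_m$: (1) remove the top-left entry, leaving an empty box; (2) while the empty box has a box to its right or below, slide into it the smaller of the entries of those boxes; (3) then replace each remaining entry $i_k$ by $i_{k-1}$; (4) place $i_m$ in the empty box. $\mathrm{pr}$ is the least $t\ge1$ with $\mathcal P^t$ equal to the identity on the given tableau. A near-hook is a standard Young tableau $T[n]$ of shape $(n-|T|,2,1^{|T|-2})$, so $T$ has shape $(2,1^{|T|-2})$; the entry in the second box of the first row of $T$ is its top-right entry, and the other entries of $T$ form its first column. Consider $\{2,\dots,n\}$ in the cyclic order $2\to3\to\dots\to n\to2$ (i.e. identified with $\mathbb Z/(n-1)$). $\mathsf T_{\text{near-hook}}(n,r)$ is the set of near-hooks $T[n]$ such that the entries of $T$ can be partitioned into exactly $r$ runs, each a set of at least $2$ cyclically consecutive elements of $\{2,\dots,n\}$ (so a run may wrap around from $n$ to $2$), and such that, considering only the first-column entries of each run, for cyclically consecutive runs $R,R'$ the difference (first first-column entry of $R'$) $-$ (last first-column entry of $R$), taken modulo $n-1$, is always at least $3$.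
   Formalization: The formal version also requires that the top-right entry of T is not strictly inside a run (each run's first-column entries are cyclically consecutive); otherwise the claim fails: n=6, T with rows (4 5),(6), r=1 has period 12, which does not divide 4. -}

module Defs where

open import Data.Bool.Base using (if_then_else_)
open import Data.List.Base
  using (List; []; _∷_; _++_; _∷ʳ_; length; map; concat; concatMap; filter;
         take; drop; head; last; replicate; upTo; iterate; zip)
open import Data.List.Extrema.Nat using (max)
open import Data.List.Relation.Binary.Permutation.Propositional using (_↭_)
open import Data.List.Relation.Binary.Prefix.Heterogeneous using (Prefix)
open import Data.List.Relation.Unary.All using (All)
open import Data.List.Relation.Unary.Linked using (Linked)
open import Data.Maybe.Base using (Maybe; just; nothing; maybe′)
open import Data.Nat.Base using (ℕ; suc; _+_; _∸_; _≤_; _<_; _>_; _<ᵇ_; _≡ᵇ_)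
open import Data.Nat.GeneralisedArithmetic using (fold)
open import Data.Nat.Properties using (_<?_; _≟_)
open import Data.Product.Base using (_×_; _,_; ∃₂)
open import Relation.Binary.PropositionalEquality.Core using (_≡_)

open import Data.List.Membership.DecPropositional _≟_ using (_∈?_; _∉?_)

-- The list of rows, from top to bottom.
Tableau : Set
Tableau = List (List ℕ)

entries : Tableau → List ℕ
entries = concat

size : Tableau → ℕ
size T = length (entries T)

shape : Tableau → List ℕ
shape = map length

firstColumn : Tableau → List ℕ
firstColumn = concatMap (take 1)

[1⋯_] : ℕ → List ℕ
[1⋯ n ] = map suc (upTo n)

infix 8 _[_]

_[_] : Tableau → ℕ → Tableau
T [ n ] = filter (_∉? entries T) [1⋯ n ] ∷ T

-- `Prefix _>_ lower upper` says that the lower row is no longer than the upper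
-- one and that each of its entries exceeds the entry just above it.
record IsStandard (n : ℕ) (T : Tableau) : Set where
  field
    entries-1⋯n        : entries T ↭ [1⋯ n ]
    rows-increasing    : All (Linked _<_) T
    columns-increasing : Linked (λ upper lower → Prefix _>_ lower upper) T

------------------------------------------------------------------------
-- Promotion

-- A tableau in which the empty box is marked by `nothing`.
Punctured : Set
Punctured = List (List (Maybe ℕ))

-- `slide left right rows` performs all the slides, for an empty box that has
-- the entries `left` and `right` on either side of it in its row, and the rows
-- `rows` below it; `slideAbove` is the same when there is at least one row below.
mutual
  slide : List ℕ → List ℕ → List (List ℕ) → Punctured
  slide left right       (row ∷ rows) = slideAbove left right row rows
  slide left []          []           = (map just left ∷ʳ nothing) ∷ []
  slide left (x ∷ right) []           = slide (left ∷ʳ x) right []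

  slideAbove : List ℕ → List ℕ → List ℕ → List (List ℕ) → Punctured
  slideAbove left right row rows with drop (length left) row
  slideAbove left []          row rows | []     =
    (map just left ∷ʳ nothing) ∷ map (map just) (row ∷ rows)
  slideAbove left (x ∷ right) row rows | []     =
    slideAbove (left ∷ʳ x) right row rows
  slideAbove left []          row rows | y ∷ ys =
    map just (left ∷ʳ y) ∷ slide (take (length left) row) ys rows
  slideAbove left (x ∷ right) row rows | y ∷ ys =
    if x <ᵇ y
    then slideAbove (left ∷ʳ x) right row rows
    else map just (left ++ y ∷ x ∷ right) ∷ slide (take (length left) row) ys rows

removeTopLeft : Tableau → Punctured
removeTopLeft ((_ ∷ right) ∷ rows) = slide [] right rows
removeTopLeft T                    = map (map just) T

-- The entry i_{k-1} when x = i_k, where i_1 < … < i_m are the entries of T.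
predecessor : Tableau → ℕ → ℕ
predecessor T x = max 0 (filter (_<? x) (entries T))

promotion : Tableau → Tableau
promotion T =
  map (map (maybe′ (predecessor T) (max 0 (entries T)))) (removeTopLeft T)

-- t is the least positive integer with 𝒫ᵗ(T) = T.
record IsPromotionPeriod (T : Tableau) (t : ℕ) : Set where
  field
    positive : 1 ≤ t
    fixes    : fold T promotion t ≡ T
    least    : ∀ s → 1 ≤ s → fold T promotion s ≡ T → t ≤ s

------------------------------------------------------------------------
-- Near-hooks

-- The standardness of T [ n ] makes the entries of T distinct, positive and
-- at most n, and 2 ≤ size T because of the shape, so neither subtraction
-- truncates.
record IsNearHook (n : ℕ) (T : Tableau) : Set where
  field
    standard : IsStandard n (T [ n ])
    shape-≡  : shape (T [ n ]) ≡ (n ∸ size T) ∷ 2 ∷ replicate (size T ∸ 2) 1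

-- The cyclic order 2 → 3 → ⋯ → n → 2.
next : ℕ → ℕ → ℕ
next n x = if x ≡ᵇ n then 2 else suc x

-- For a, b in {2,…,n}: the representative of b - a modulo n - 1 in
-- {1,…,n-1}, that is, the number of steps of `next n` from a to the next
-- occurrence of b.  In particular it is n - 1, a full turn, when a = b; this
-- only matters for a single run with a single first-column entry.
cyclicDifference : ℕ → ℕ → ℕ → ℕ
cyclicDifference n a b = if a <ᵇ b then b ∸ a else (b + (n ∸ 1)) ∸ a

record Run : Set where
  constructor run
  field
    start  : ℕ
    extent : ℕ

open Run public

-- In cyclic order, beginning with the start of the run.
elements : ℕ → Run → List ℕ
elements n R = iterate (next n) (start R) (extent R)

record IsRun (n : ℕ) (R : Run) : Set where
  field
    2≤start    : 2 ≤ start R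
    start≤n    : start R ≤ n
    2≤extent   : 2 ≤ extent R
    extent≤n-1 : extent R ≤ n ∸ 1

firstColumnPart : ℕ → Tableau → Run → List ℕ
firstColumnPart n T R = filter (_∈? firstColumn T) (elements n R)

cyclicPairs : ∀ {A : Set} → List A → List (A × A)
cyclicPairs []       = []
cyclicPairs (x ∷ xs) = zip (x ∷ xs) (xs ∷ʳ x)

GapAtLeast3 : ℕ → Tableau → Run × Run → Set
GapAtLeast3 n T (R , R′) = ∃₂ λ a b →
  last (firstColumnPart n T R) ≡ just a ×
  head (firstColumnPart n T R′) ≡ just b ×
  3 ≤ cyclicDifference n a b

-- Disjoint runs listed by increasing start are listed in cyclic order.
--
-- The gap condition views the first-column entries of a run as a block with a
-- first and a last entry, and `blocks` makes this explicit: what a run has in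
-- the first column is itself cyclically consecutive, i.e. the top-right entry
-- of T is not strictly inside a run, where it would leave two blocks with
-- difference 2.  Without it the period need not divide (2r-1)n - 2r: for
-- n = 6 and T with rows (4 5) and (6), the only run is {4,5,6}, with
-- 4 - 6 ≡ 3 modulo 5, but the period is 12, which does not divide 4.
record HasRuns (n r : ℕ) (T : Tableau) : Set where
  field
    runs      : List Run
    number    : length runs ≡ r
    valid     : All (IsRun n) runs
    ordered   : Linked _<_ (map start runs)
    partition : concatMap (elements n) runs ↭ entries T
    blocks    : All (λ R → ∃₂ λ s k → firstColumnPart n T R ≡ iterate (next n) s k) runs
    gaps      : All (GapAtLeast3 n T) (cyclicPairs runs)

-- T [ n ] belongs to 𝖳_near-hook(n , r).
record InNearHookClass (n r : ℕ) (T : Tableau) : Set where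
  field
    nearHook : IsNearHook n T
    hasRuns  : HasRuns n r T

{-# OPTIONS --safe #-}
module Submission where

-- Write T[n] as a word on the positions 2,…,n, with C for the first column of T,
-- R for the top row and D for the top-right entry of T, and read it cyclically
-- from a point that moves on by one letter at each promotion.  In this frame
-- nothing moves, except when the reading point is at a letter x followed by
-- y…y D with y ≠ x: then x and D are exchanged.  So D jumps to the left over one
-- monochromatic block at a time, x yᵃ D ↦ D yᵃ x.  The runs and the gap condition
-- say that the cyclic word has 2r blocks, of length at least 2 unless they are
-- adjacent to D, and that the two neighbours of D differ; hence no block ever
-- vanishes, and 2r jumps shift every letter by one place to the left.  A jump
-- over yᵃ displaces D by a + 1 and takes n - 1 - (a + 1) promotions; the 2r
-- displacements add up to n, which makes 2r(n - 1) - n = (2r - 1)n - 2r promotions.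

-- The rule for exchanges comes from the path of the empty box. It first enters the box of the
-- letter `x` at the reading point, in the row or in the column; from there it turns into the box of
-- `D` exactly when `D` is smaller than the next entry of that row or column, that is, when no other
-- `x` stands before `D`. The bounds on the block lengths come from the letters lent. A jump over a
-- block uses the last letter of the block to its left. A block that is not next to `D` thus loses a
-- letter before it is jumped over itself; if it had only one, it would be used up, and `D` would
-- have equal letters on both sides. The two blocks next to `D` are safe with one letter: the left
-- one is jumped over first, at full length, and the right one consists of the letter used in the
-- first jump, because the neighbours of `D` differ, and has received that letter when its turn
-- comes.

open import Defs
open import Data.Bool.Base using (Bool; true; false; not; if_then_else_)
import Data.Bool.Properties as Bool
open import Data.Empty using (⊥; ⊥-elim)
open import Data.List.Base
  using (List; []; _∷_; _++_; _∷ʳ_; length; map; concatMap; filter; head; last; replicate; iterate; zip)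
open import Data.List.Extrema.Nat using (max; max≤v⁺; v≤max⁺)
open import Data.List.Membership.Propositional using (_∈_; lose)
open import Data.List.Membership.Propositional.Properties
  using (∈-++⁺ʳ; ∈-++⁺ˡ; ∈-++⁻; ∈-filter⁺; ∈-filter⁻; ∈-map⁺; ∈-map⁻; ∈-upTo⁺; ∈-upTo⁻)
open import Data.List.Properties
  using (length-++; length-iterate; length-map; ++-assoc; ++-identityʳ; concat-map-[_];
         concatMap-++; drop-[]; map-∘; map-++; map-cong-local; filter-all; filter-reject; filter-++;
         ≡-dec; ∷-injectiveʳ)
open import Data.List.Relation.Binary.Permutation.Propositional
  using (_↭_; ↭-sym; ↭-trans; ↭-refl; ↭-reflexive; ↭⇒↭ₛ)
import Data.List.Relation.Binary.Permutation.Propositional.Properties as ↭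
open import Data.List.Relation.Binary.Prefix.Heterogeneous using (Prefix; []; _∷_)
open import Data.List.Relation.Unary.All as All using (All; []; _∷_; all?)
import Data.List.Relation.Unary.All.Properties as All
open import Data.List.Relation.Unary.AllPairs as AllPairs using (AllPairs; []; _∷_)
import Data.List.Relation.Unary.AllPairs.Properties as AllPairs
open import Data.List.Relation.Unary.Any as Any using (here; there)
open import Data.List.Relation.Unary.Linked using (Linked; []; [-]; _∷_)
import Data.List.Relation.Unary.Linked.Properties as Linked
open import Data.List.Relation.Unary.Unique.Propositional using (Unique)
import Data.List.Relation.Unary.Unique.Propositional.Properties as Unique
open import Data.Maybe.Base using (Maybe; just; nothing; maybe′)
open import Data.Maybe.Properties using (just-injective)
open import Data.Nat.Base
open import Data.Nat.Divisibility using (_∣_; m%n≡0⇒n∣m)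
open import Data.Nat.DivMod using (m≡m%n+[m/n]*n; m%n<n)
open import Data.Nat.GeneralisedArithmetic using (fold; fold-+) renaming (iterate to advance)
open import Data.Nat.ListAction using (sum)
open import Data.Nat.Properties
open import Data.Nat.Tactic.RingSolver using (solve-∀)
open import Data.Product.Base using (_×_; _,_; ∃; ∃₂; proj₁; proj₂)
open import Data.Sum.Base as Sum using (_⊎_; inj₁; inj₂)
open import Function.Base using (_∘_; case_of_)
open import Relation.Binary.Definitions using (DecidableEquality)
open import Relation.Binary.PropositionalEquality hiding ([_])
open import Relation.Nullary using (¬_; does; yes; no)
open import Relation.Nullary.Decidable using (dec-true; dec-false)

open import Data.List.Membership.DecPropositional _≟_ using (_∈?_; _∉?_)

open ≡-Reasoning

-- The dynamics on words

-- The word p D s, with C = true, R = false and the reading point at its start.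
State : Set
State = List Bool × List Bool

-- For the letters before `D` this is the standardness of the top-right entry of `T`: it exceeds the
-- box on its left, a `true`, and the box above it, a `false`.
Mixed : List Bool → Set
Mixed p = ∀ b → b ∈ p

-- After an exchange `D` is the letter just read, so it goes to the end of the word and nothing is
-- left behind it. The clause for `[]` is a default value, excluded by `Mixed`.
step : State → State
step ([]    , s) = [] , s
step (x ∷ p , s) =
  if does (all? (Bool._≟ not x) p) then (p ++ x ∷ s , []) else (p , s ∷ʳ x)

step-jump : ∀ {x p} s → All (_≡ not x) p → step (x ∷ p , s) ≡ (p ++ x ∷ s , [])
step-jump {x} {p} s h rewrite dec-true (all? (Bool._≟ not x) p) h = refl

Mixed⇒¬All : ∀ {p} x → Mixed p → ¬ All (_≡ x) p
Mixed⇒¬All x m h = Bool.not-¬ refl (sym (All.lookup h (m (not x))))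

step-turn : ∀ {x p} s → Mixed p → step (x ∷ p , s) ≡ (p , s ∷ʳ x)
step-turn {x} {p} s m
  rewrite dec-false (all? (Bool._≟ not x) p) (Mixed⇒¬All (not x) m) = refl

fold-suc : ∀ {A : Set} (f : A → A) z n → fold (f z) f n ≡ fold z f (suc n)
fold-suc f z zero    = refl
fold-suc f z (suc n) = cong f (fold-suc f z n)

infix 4 _⟶[_]_

_⟶[_]_ : State → ℕ → State → Set
a ⟶[ m ] b = fold a step m ≡ b

⟶-trans : ∀ {a b c} m n → a ⟶[ m ] b → b ⟶[ n ] c → a ⟶[ n + m ] c
⟶-trans {a} m n refl refl = fold-+ a step n {m}

-- As long as a mixed `p` remains before `D`, what follows a letter of `u` is never monochromatic,
-- so no letter of `u` causes an exchange.
⟶-turn : ∀ u {p} s → Mixed p → (u ++ p , s) ⟶[ length u ] (p , s ++ u)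
⟶-turn []      s m = cong (_ ,_) (sym (++-identityʳ s))
⟶-turn (x ∷ u) {p} s m = begin
  fold (x ∷ u ++ p , s) step (suc (length u))  ≡⟨ fold-suc step _ (length u) ⟨
  fold (step (x ∷ u ++ p , s)) step (length u) ≡⟨ cong (λ a → fold a step (length u)) (step-turn s (λ b → ∈-++⁺ʳ u (m b))) ⟩
  fold (u ++ p , s ∷ʳ x) step (length u)       ≡⟨ ⟶-turn u (s ∷ʳ x) m ⟩
  (p , s ∷ʳ x ++ u)                            ≡⟨ cong (p ,_) (++-assoc s (x ∷ []) u) ⟩
  (p , s ++ x ∷ u)                             ∎

Mixed-block : ∀ x a → Mixed (x ∷ replicate (suc a) (not x))
Mixed-block true  a true  = here refl
Mixed-block true  a false = there (here refl)
Mixed-block false a true  = there (here refl)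
Mixed-block false a false = here refl

-- Words with `D` at the end serve as normal form, since every exchange produces one. All of `u` is
-- read without an exchange because `x` and the block after it are mixed; the exchange occurs at
-- `x`.
⟶-jump : ∀ u x a →
  (u ++ x ∷ replicate (suc a) (not x) , []) ⟶[ suc (length u) ]
  (replicate (suc a) (not x) ++ x ∷ u , [])
⟶-jump u x a = ⟶-trans (length u) 1 (⟶-turn u [] (Mixed-block x a))
  (step-jump u (All.replicate⁺ (suc a) refl))

-- u y consists of a block of x's and k further blocks of length at least 2, the
-- last of them of y's; only this y is missing from u.
data Blocks (x : Bool) : ℕ → Bool → List Bool → Set where
  single : ∀ a → Blocks x 0 x (replicate a x)
  append : ∀ {k y u} → Blocks x k y u → ∀ b →
           Blocks x (suc k) (not y) (u ++ y ∷ replicate (suc b) (not y))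

replicate-∷ : ∀ {A : Set} n (x : A) xs → x ∷ replicate n x ++ xs ≡ replicate n x ++ x ∷ xs
replicate-∷ zero    x xs = refl
replicate-∷ (suc n) x xs = cong (x ∷_) (replicate-∷ n x xs)

-- The invariant behind the induction: when D has jumped over everything to the
-- right of u z, what it has passed reappears in front, shifted by one letter.
Blocks-⟶ : ∀ {x k z u} → Blocks x k z u → ∀ τ →
  ∃ λ c → c + length u + 2 ≡ suc k * (length τ + length u + 3) ×
          (τ ++ not x ∷ x ∷ u , []) ⟶[ c ] (u ++ z ∷ not z ∷ τ , [])
Blocks-⟶ {x} (single a) τ =
  -- A full turn takes `length τ + length u + 3` promotions, one for each letter and one for `D`.
  -- The equation says that `suc k` jumps take as many turns, less the distance `length u + 2` that
  -- `D` travels. Here a single jump is left.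
  suc (length τ) , count (length τ) (length (replicate a x)) ,
  trans (subst (λ y → (τ ++ not x ∷ replicate (suc a) y , []) ⟶[ suc (length τ) ]
                      (replicate (suc a) y ++ not x ∷ τ , []))
               (Bool.not-involutive x) (⟶-jump τ (not x) a))
        (cong (_, []) (replicate-∷ a x _))
  where
  count : ∀ t a → suc t + a + 2 ≡ 1 * (t + a + 3)
  count = solve-∀
Blocks-⟶ {x} (append {k} {y} {u} B b) τ
  -- The block just passed and the letter `y` now stand at the front of the word, so they are added
  -- to `τ`.
  with Blocks-⟶ B (replicate (suc b) (not y) ++ y ∷ τ)
... | c , eq , path =
  c + suc (length v) , count′ ,
  ⟶-trans (suc (length v)) c
    (trans (cong (λ w → fold (w , []) step (suc (length v))) e₁) (trans (⟶-jump v y b) (cong (_, []) e₂)))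
    (trans path (cong (_, []) e₃))
  where
  rep v : List Bool
  rep = replicate (suc b) (not y)
  v   = τ ++ not x ∷ x ∷ u
  e₁ : τ ++ not x ∷ x ∷ u ++ y ∷ rep ≡ v ++ y ∷ rep
  e₁ = sym (++-assoc τ _ _)
  e₂ : rep ++ y ∷ τ ++ not x ∷ x ∷ u ≡ (rep ++ y ∷ τ) ++ not x ∷ x ∷ u
  e₂ = sym (++-assoc rep _ _)
  e₃ : u ++ y ∷ not y ∷ rep ++ y ∷ τ ≡ (u ++ y ∷ rep) ++ not y ∷ not (not y) ∷ τ
  e₃ = trans (cong (λ w → u ++ y ∷ w)
               (trans (replicate-∷ (suc b) (not y) (y ∷ τ))
                      (cong (λ z → rep ++ not y ∷ z ∷ τ) (sym (Bool.not-involutive y)))))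
             (sym (++-assoc u (y ∷ rep) _))
  count : ∀ c t u b k → c + u + 2 ≡ suc k * ((b + suc t) + u + 3) →
          (c + suc (t + suc (suc u))) + (u + suc b) + 2 ≡ suc (suc k) * (t + (u + suc b) + 3)
  count c t u b k eq = begin
    (c + suc (t + suc (suc u))) + (u + suc b) + 2 ≡⟨ l₁ c t u b ⟩
    (c + u + 2) + (t + (u + suc b) + 3)           ≡⟨ cong (_+ (t + (u + suc b) + 3)) eq ⟩
    suc k * ((b + suc t) + u + 3) + (t + (u + suc b) + 3) ≡⟨ l₂ t u b k ⟩
    suc (suc k) * (t + (u + suc b) + 3) ∎
    where
    l₁ : ∀ c t u b → (c + suc (t + suc (suc u))) + (u + suc b) + 2 ≡ (c + u + 2) + (t + (u + suc b) + 3)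
    l₁ = solve-∀
    l₂ : ∀ t u b k → suc k * ((b + suc t) + u + 3) + (t + (u + suc b) + 3) ≡ suc (suc k) * (t + (u + suc b) + 3)
    l₂ = solve-∀
  count′ : (c + suc (length v)) + length (u ++ y ∷ rep) + 2 ≡
           suc (suc k) * (length τ + length (u ++ y ∷ rep) + 3)
  count′ rewrite length-++ u {y ∷ rep} | length-++ τ {not x ∷ x ∷ u} =
    count c (length τ) (length u) (length rep) k
      (trans eq (cong (λ l → suc k * (l + length u + 3)) (length-++ rep)))

-- One jump over the last block gives the situation of `Blocks-⟶`, with `τ` the rest of that block;
-- since `u` begins and ends with the same letter `x`, the word that comes out is `v` again. These
-- are `k + 2` jumps: for `k = 2(r - 1)` the `2r` of the overview.
Blocks-period : ∀ {x k u} → Blocks x k x u → ∀ a →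
  let v = u ++ x ∷ replicate (suc a) (not x) in
  ∃ λ M → suc M ≡ suc k * suc (length v) × (v , []) ⟶[ M ] (v , [])
Blocks-period {x} {k} {u} B a with Blocks-⟶ B (replicate a (not x))
... | c , eq , path =
  c + suc (length u) , count′ , ⟶-trans (suc (length u)) c
    (trans (⟶-jump u x a) (cong (_, []) (replicate-∷ a (not x) (x ∷ u)))) path
  where
  l₁ : ∀ c u → suc (c + suc u) ≡ c + u + 2
  l₁ = solve-∀
  l₂ : ∀ a u → a + u + 3 ≡ suc (u + suc (suc a))
  l₂ = solve-∀
  count′ : suc (c + suc (length u)) ≡ suc k * suc (length (u ++ x ∷ replicate (suc a) (not x)))
  count′ rewrite length-++ u {x ∷ replicate (suc a) (not x)} =
    trans (l₁ c (length u)) (trans eq (cong (suc k *_) (l₂ (length (replicate a (not x))) (length u))))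

-- Promotion of the tableau of a word

positions : Bool → ℕ → List Bool → List ℕ
positions b k []      = []
positions b k (x ∷ p) =
  if does (x Bool.≟ b) then k ∷ positions b (suc k) p else positions b (suc k) p

positions-++ : ∀ b k p q → positions b k (p ++ q) ≡ positions b k p ++ positions b (k + length p) q
positions-++ b k []      q = cong (λ l → positions b l q) (sym (+-identityʳ k))
positions-++ b k (x ∷ p) q rewrite +-suc k (length p) with x Bool.≟ b
... | yes _ = cong (k ∷_) (positions-++ b (suc k) p q)
... | no  _ = positions-++ b (suc k) p q

positions-bounds : ∀ b k p → All (λ i → k ≤ i × i < k + length p) (positions b k p)
positions-bounds b k []      = []
positions-bounds b k (x ∷ p) with x Bool.≟ b | positions-bounds b (suc k) p
... | yes _ | h rewrite +-suc k (length p) =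
  (≤-refl , s≤s (m≤m+n k _)) ∷ All.map (λ (l , u) → <⇒≤ l , u) h
... | no  _ | h rewrite +-suc k (length p) = All.map (λ (l , u) → <⇒≤ l , u) h

positions-cover : ∀ k p {i} → k ≤ i → i < k + length p →
                  i ∈ positions true k p ⊎ i ∈ positions false k p
positions-cover k []      l u rewrite +-identityʳ k = ⊥-elim (<⇒≱ u l)
positions-cover k (x ∷ p) l u with m≤n⇒m<n∨m≡n l
positions-cover k (true  ∷ p) l u | inj₂ refl = inj₁ (here refl)
positions-cover k (false ∷ p) l u | inj₂ refl = inj₂ (here refl)
positions-cover k (x ∷ p) l u | inj₁ l′
  with x | positions-cover (suc k) p l′ (≤-trans u (≤-reflexive (+-suc k (length p))))
... | true  | h = Sum.map₁ there h
... | false | h = Sum.map₂ there h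

positions-head : ∀ {b p} k → b ∈ p →
                 ∃₂ λ i is → positions b k p ≡ i ∷ is × k ≤ i × i < k + length p
positions-head {b} {x ∷ p} k m with x Bool.≟ b | positions-bounds b k (x ∷ p)
... | yes _ | (l , u) ∷ _ = k , _ , refl , l , u
positions-head {b} {x ∷ p} k (here refl) | no ¬e | _ = ⊥-elim (¬e refl)
positions-head {b} {x ∷ p} k (there m)   | no _  | _ with positions-head (suc k) m
... | i , is , eq , l , u rewrite +-suc k (length p) = i , is , eq , <⇒≤ l , u

positions-none : ∀ {b p} k → All (_≡ not b) p → positions b k p ≡ []
positions-none k [] = refl
positions-none {true}  k (refl ∷ h) = positions-none (suc k) h
positions-none {false} k (refl ∷ h) = positions-none (suc k) h

map-pred-positions : ∀ b k p → map pred (positions b (suc k) p) ≡ positions b k p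
map-pred-positions b k []      = refl
map-pred-positions b k (x ∷ p) with does (x Bool.≟ b)
... | true  = cong (k ∷_) (map-pred-positions b (suc k) p)
... | false = map-pred-positions b (suc k) p

-- The rows of `T` from its first column and its top-right entry. It is polymorphic so as to hold
-- boxes that may be empty as well; the clause for `[]` is a default value.
lower : ∀ {A : Set} → List A → A → List (List A)
lower []       d = []
lower (c ∷ cs) d = (c ∷ d ∷ []) ∷ map (_∷ []) cs

statePositions : Bool → State → List ℕ
statePositions b (p , s) = positions b 2 p ++ positions b (3 + length p) s

tableau : State → Tableau
tableau (p , s) = (1 ∷ statePositions false (p , s)) ∷ lower (statePositions true (p , s)) (2 + length p)

stateSize : State → ℕ
stateSize (p , s) = 2 + (length p + length s)

map-lower : ∀ {A B : Set} (g : A → B) cs d → map (map g) (lower cs d) ≡ lower (map g cs) (g d)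
map-lower g []       d = refl
map-lower g (c ∷ cs) d = cong ((g c ∷ g d ∷ []) ∷_) (trans (sym (map-∘ cs)) (map-∘ cs))

-- The path of the empty box

<ᵇ-true : ∀ {m n} → m < n → (m <ᵇ n) ≡ true
<ᵇ-true {m} {n} h = dec-true (m <? n) h

<ᵇ-false : ∀ {m n} → n ≤ m → (m <ᵇ n) ≡ false
<ᵇ-false {m} {n} h = dec-false (m <? n) (≤⇒≯ h)

-- The second row has two boxes, so from the third column on there is nothing below the empty box
-- and it can only move to the right.
slideAbove-past : ∀ a b left right y z rows →
  slideAbove (a ∷ b ∷ left) right (y ∷ z ∷ []) rows ≡
  (map just (a ∷ b ∷ left ++ right) ∷ʳ nothing) ∷ map (map just) ((y ∷ z ∷ []) ∷ rows)
slideAbove-past a b left [] y z rows rewrite drop-[] {A = ℕ} (length left) | ++-identityʳ left = refl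
slideAbove-past a b left (x ∷ right) y z rows rewrite drop-[] {A = ℕ} (length left) =
  trans (slideAbove-past a b (left ∷ʳ x) right y z rows)
        (cong (λ l → (map just (a ∷ b ∷ l) ∷ʳ nothing) ∷ map (map just) ((y ∷ z ∷ []) ∷ rows))
              (++-assoc left (x ∷ []) right))

slide-column : ∀ cs → slide [] [] (map (_∷ []) cs) ≡ map (_∷ []) (map just cs ∷ʳ nothing)
slide-column []       = refl
slide-column (c ∷ cs) = cong ((just c ∷ []) ∷_) (slide-column cs)

slide-end : ∀ c cs → slide (c ∷ []) [] (map (_∷ []) cs) ≡ lower (map just (c ∷ cs)) nothing
slide-end c []       = refl
slide-end c (_ ∷ cs) = cong (λ rows → (just c ∷ nothing ∷ []) ∷ (just _ ∷ []) ∷ rows)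
  (trans (sym (map-∘ cs)) (map-∘ cs))

module _ {as col : List ℕ} {d : ℕ} where

  -- The entry 2 lies in the top row, the letter read is `false`. From its box the empty box prefers
  -- `x` to `d`, and has then passed the only column by which it could leave the row.
  slide-row : ∀ {x xs c cs} → as ≡ x ∷ xs → x < d → col ≡ c ∷ cs → 2 < c →
    removeTopLeft ((1 ∷ 2 ∷ as) ∷ lower col d) ≡
    (map just (2 ∷ as) ∷ʳ nothing) ∷ lower (map just col) (just d)
  slide-row {x} {xs} {c} {cs} refl x<d refl 2<c rewrite <ᵇ-true 2<c | <ᵇ-true x<d =
    trans (slideAbove-past 2 x [] xs c d (map (_∷ []) cs))
          (cong ((map just (2 ∷ x ∷ xs) ∷ʳ nothing) ∷_) (map-lower just (c ∷ cs) d))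

  -- With no `false` before `D`, the entry `d` moves up into the row. The box it leaves is a corner
  -- of the shape, so the sliding stops there, and that box will receive `n`.
  slide-row-corner : ∀ {c cs} → All (d <_) as → col ≡ c ∷ cs → 2 < c →
    removeTopLeft ((1 ∷ 2 ∷ as) ∷ lower col d) ≡
    map just (2 ∷ d ∷ as) ∷ lower (map just col) nothing
  slide-row-corner {c} {cs} [] refl 2<c rewrite <ᵇ-true 2<c =
    cong (map just (2 ∷ d ∷ []) ∷_) (slide-end c cs)
  slide-row-corner {c} {cs} (d<x ∷ _) refl 2<c rewrite <ᵇ-true 2<c | <ᵇ-false (<⇒≤ d<x) =
    cong (map just (2 ∷ d ∷ as) ∷_) (slide-end c cs)

  -- The same exchange when 2 lies in the first column: `d` moves to the left instead of up, and the
  -- empty box stops in the same corner.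
  slide-column-corner : ∀ {x xs} → as ≡ x ∷ xs → 2 < x → All (d <_) col →
    removeTopLeft ((1 ∷ as) ∷ lower (2 ∷ col) d) ≡
    map just (2 ∷ as) ∷ lower (just d ∷ map just col) nothing
  slide-column-corner refl 2<x [] rewrite <ᵇ-false (<⇒≤ 2<x) = refl
  slide-column-corner refl 2<x (d<c ∷ _) rewrite <ᵇ-false (<⇒≤ 2<x) | <ᵇ-true d<c =
    cong (λ rows → map just (2 ∷ as) ∷ (just d ∷ nothing ∷ []) ∷ (just _ ∷ []) ∷ rows)
         (trans (sym (map-∘ _)) (map-∘ _))

  slide-first-column : ∀ {x xs c cs} → as ≡ x ∷ xs → 2 < x → col ≡ c ∷ cs → c < d →
    removeTopLeft ((1 ∷ as) ∷ lower (2 ∷ col) d) ≡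
    map just (2 ∷ as) ∷ lower (map just col ∷ʳ nothing) (just d)
  slide-first-column {cs = cs} refl 2<x refl c<d rewrite <ᵇ-false (<⇒≤ 2<x) | <ᵇ-false (<⇒≤ c<d) =
    cong (λ rows → map just (2 ∷ as) ∷ (just _ ∷ just d ∷ []) ∷ rows) (slide-column cs)

-- Relabelling after the slides

module _ {T : Tableau} {n : ℕ}
         (sound    : All (_≤ n) (entries T))
         (complete : ∀ {i} → 1 ≤ i → i ≤ n → i ∈ entries T) where

  predecessor-pred : ∀ {i} → 2 ≤ i → i ≤ n → predecessor T i ≡ pred i
  predecessor-pred {suc i} (s≤s 1≤i) i≤n = ≤-antisym
    (max≤v⁺ z≤n (All.map ≤-pred (All.all-filter (_<? suc i) (entries T))))
    (v≤max⁺ 0 _ (inj₂ (lose (∈-filter⁺ (_<? suc i) (complete 1≤i (<⇒≤ i≤n)) ≤-refl) ≤-refl)))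

  max-entries : 1 ≤ n → max 0 (entries T) ≡ n
  max-entries 1≤n = ≤-antisym (max≤v⁺ z≤n sound)
    (v≤max⁺ 0 _ (inj₂ (lose (complete 1≤n ≤-refl) ≤-refl)))

∈-insert-second : ∀ {A : Set} {x y z : A} {ys} → x ∈ y ∷ ys → x ∈ y ∷ z ∷ ys
∈-insert-second (here e)  = here e
∈-insert-second (there h) = there (there h)

entries-tableau : ∀ row {c cs} d → entries (row ∷ lower (c ∷ cs) d) ≡ row ++ c ∷ d ∷ cs
entries-tableau row {c} {cs} d = cong (λ l → row ++ c ∷ d ∷ l) (concat-map-[ cs ])

module _ {p s : List Bool} where

  statePositions-bounds : ∀ b → All (λ i → 2 ≤ i × i ≤ stateSize (p , s)) (statePositions b (p , s))
  statePositions-bounds b = All.++⁺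
    (All.map (λ (l , u) → l , ≤-trans (<⇒≤ u) (+-monoʳ-≤ 2 (m≤m+n _ _))) (positions-bounds b 2 p))
    (All.map (λ (l , u) → ≤-trans (m≤m+n 2 _) l , ≤-pred u) (positions-bounds b (3 + length p) s))

  statePositions-cover : ∀ {i} → 2 ≤ i → i ≤ stateSize (p , s) → i ≢ 2 + length p →
    i ∈ statePositions true (p , s) ⊎ i ∈ statePositions false (p , s)
  statePositions-cover {i} l u i≢d with i <? 2 + length p
  ... | yes i<d = Sum.map ∈-++⁺ˡ ∈-++⁺ˡ (positions-cover 2 p l i<d)
  ... | no  i≮d = Sum.map (∈-++⁺ʳ (positions true 2 p)) (∈-++⁺ʳ (positions false 2 p))
    (positions-cover (3 + length p) s (≤∧≢⇒< (≮⇒≥ i≮d) (i≢d ∘ sym)) (s≤s u))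

  module _ (m : Mixed p) where

    private
      column-head : ∃₂ λ c cs → statePositions true (p , s) ≡ c ∷ cs
      column-head with positions-head 2 (m true)
      ... | i , is , eq , _ = i , _ , cong (_++ positions true (3 + length p) s) eq

    tableau-sound : All (_≤ stateSize (p , s)) (entries (tableau (p , s)))
    tableau-sound with statePositions true (p , s) | statePositions-bounds true | column-head
    ... | c ∷ cs | (_ , c≤n) ∷ h | _
      rewrite entries-tableau (1 ∷ statePositions false (p , s)) {c} {cs} (2 + length p) =
      s≤s z≤n ∷ All.++⁺ (All.map proj₂ (statePositions-bounds false))
                        (c≤n ∷ +-monoʳ-≤ 2 (m≤m+n _ _) ∷ All.map proj₂ h)

    tableau-complete : ∀ {i} → 1 ≤ i → i ≤ stateSize (p , s) → i ∈ entries (tableau (p , s))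
    tableau-complete {i} l u with m≤n⇒m<n∨m≡n l
    ... | inj₂ refl = here refl
    ... | inj₁ 2≤i
      with statePositions true (p , s) | statePositions-cover 2≤i u | column-head
    ... | c ∷ cs | cover | _
      rewrite entries-tableau (1 ∷ statePositions false (p , s)) {c} {cs} (2 + length p)
      with i ≟ 2 + length p
    ... | yes refl = there (∈-++⁺ʳ (statePositions false (p , s)) (there (here refl)))
    ... | no i≢d with cover i≢d
    ... | inj₁ k = there (∈-++⁺ʳ (statePositions false (p , s)) (∈-insert-second k))
    ... | inj₂ k = there (∈-++⁺ˡ k)

-- A second `x` occurs in `p`, so dropping the first one loses neither letter. Hence the alternative
-- to an exchange always leaves a mixed word.
Mixed-tail : ∀ {x p} → Mixed (x ∷ p) → ¬ All (_≡ not x) p → Mixed p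
Mixed-tail {x} {p} m ¬h b with b Bool.≟ x
... | yes refl = Any.map (λ y≢ → sym (trans (Bool.¬-not y≢) (Bool.not-involutive _)))
                         (All.¬All⇒Any¬ (Bool._≟ not x) p ¬h)
... | no b≢x with m b
...   | here b≡x = ⊥-elim (b≢x b≡x)
...   | there k  = k

-- The entry 2 becomes the new 1 in the top-left box, so the letter `x` disappears from the front
-- and all later positions fall by one. The new entry `n` is either the same letter at the end of
-- the word, after a turn, or the new `D`, after a jump.
module Relabelling {x : Bool} {p s : List Bool} (g : Maybe ℕ → ℕ)
  (g-just : ∀ {i} → 2 ≤ i → i ≤ stateSize (x ∷ p , s) → g (just i) ≡ pred i)
  (g-nothing : g nothing ≡ stateSize (x ∷ p , s)) where

  n : ℕ
  n = stateSize (x ∷ p , s)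

  later : Bool → List ℕ
  later b = positions b 3 p ++ positions b (4 + length p) s

  later-bounds : ∀ b → All (λ i → 2 ≤ i × i ≤ n) (later b)
  later-bounds b with x Bool.≟ b | statePositions-bounds {x ∷ p} {s} b
  ... | yes _ | _ ∷ h = h
  ... | no _  | h     = h

  g-d : g (just (3 + length p)) ≡ 2 + length p
  g-d = g-just (s≤s (s≤s z≤n)) (+-monoʳ-≤ 3 (m≤m+n _ _))

  g-2 : g (just 2) ≡ 1
  g-2 = g-just ≤-refl (s≤s (s≤s z≤n))

  g-later : ∀ b → map g (map just (later b)) ≡ statePositions b (p , s)
  g-later b = begin
    map g (map just (later b))             ≡⟨ map-∘ (later b) ⟨
    map (g ∘ just) (later b)               ≡⟨ map-cong-local (All.map (λ (l , u) → g-just l u) (later-bounds b)) ⟩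
    map pred (later b)                     ≡⟨ map-++ pred (positions b 3 p) _ ⟩
    map pred (positions b 3 p) ++ map pred (positions b (4 + length p) s)
      ≡⟨ cong₂ _++_ (map-pred-positions b 2 p) (map-pred-positions b (3 + length p) s) ⟩
    statePositions b (p , s)               ∎

  later-head : ∀ b → b ∈ p → ∃₂ λ i is → later b ≡ i ∷ is × 2 < i × i < 3 + length p
  later-head b k with positions-head 3 k
  ... | i , is , eq , l , u = i , _ , cong (_++ positions b (4 + length p) s) eq , l , u

  later-none : ∀ b → All (_≡ not b) p → All (3 + length p <_) (later b)
  later-none b h rewrite positions-none 3 h = All.map proj₁ (positions-bounds b (4 + length p) s)

  turn-same : statePositions x (p , s ∷ʳ x) ≡ statePositions x (p , s) ∷ʳ n
  turn-same = trans (cong (positions x 2 p ++_) (trans (positions-++ x _ s (x ∷ [])) (cong (positions x (3 + length p) s ++_) (last-position x))))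
                    (sym (++-assoc (positions x 2 p) _ _))
    where
    last-position : ∀ x {k} → positions x k (x ∷ []) ≡ k ∷ []
    last-position true  = refl
    last-position false = refl

  turn-other : statePositions (not x) (p , s ∷ʳ x) ≡ statePositions (not x) (p , s)
  turn-other = cong (positions (not x) 2 p ++_) (trans (positions-++ (not x) _ s (x ∷ []))
    (trans (cong (positions (not x) (3 + length p) s ++_) (no-position x)) (++-identityʳ _)))
    where
    no-position : ∀ x {k} → positions (not x) k (x ∷ []) ≡ []
    no-position true  = refl
    no-position false = refl

  jump-positions : ∀ b → statePositions b (p ++ x ∷ s , []) ≡ positions b 2 p ++ positions b (2 + length p) (x ∷ s)
  jump-positions b = trans (++-identityʳ _) (positions-++ b 2 p (x ∷ s))

  -- The old `D`, at position `3 + length p`, takes over the letter `x` and falls by one like all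
  -- others; no letter `b` stands before it.
  jump-same : ∀ b → b ≡ x → All (_≡ not b) p →
              statePositions b (p ++ x ∷ s , []) ≡ 2 + length p ∷ positions b (3 + length p) s
  jump-same b refl h = trans (jump-positions b)
    (trans (cong (_++ positions b (2 + length p) (b ∷ s)) (positions-none 2 h)) (head-position b))
    where
    head-position : ∀ b → positions b (2 + length p) (b ∷ s) ≡ 2 + length p ∷ positions b (3 + length p) s
    head-position true  = refl
    head-position false = refl

  g-later-none : ∀ b → All (_≡ not b) p → map g (map just (later b)) ≡ positions b (3 + length p) s
  g-later-none b h = trans (g-later b) (cong (_++ positions b (3 + length p) s) (positions-none 2 h))

  jump-d : 2 + length (p ++ x ∷ s) ≡ n
  jump-d = cong (2 +_) (trans (length-++ p) (+-suc _ _))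

module _ {p s : List Bool} (g : Maybe ℕ → ℕ) where

  private
    d = 3 + length p

    Correct : Bool → State → Set
    Correct x st =
      (∀ {i} → 2 ≤ i → i ≤ stateSize (x ∷ p , s) → g (just i) ≡ pred i) →
      g nothing ≡ stateSize (x ∷ p , s) →
      map (map g) (removeTopLeft (tableau (x ∷ p , s))) ≡ tableau st

  relabel-row-turn : Mixed p → Correct false (p , s ∷ʳ false)
  relabel-row-turn m g-just g-nothing
    with Relabelling.later-head {false} {p} {s} g g-just g-nothing false (m false)
       | Relabelling.later-head {false} {p} {s} g g-just g-nothing true (m true)
  ... | _ , _ , eqr , _ , x<d | _ , _ , eqc , 2<c , _ = trans
    (cong (map (map g)) (slide-row eqr x<d eqc 2<c))
    (cong₂ _∷_
      (cong₂ _∷_ g-2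
        (trans (map-++ g (map just (later false)) _)
               (trans (cong₂ _∷ʳ_ (g-later false) g-nothing) (sym turn-same))))
      (trans (map-lower g (map just (later true)) (just d))
             (cong₂ lower (trans (g-later true) (sym turn-other)) g-d)))
    where open Relabelling {false} {p} {s} g g-just g-nothing

  relabel-row-jump : true ∈ p → All (_≡ true) p → Correct false (p ++ false ∷ s , [])
  relabel-row-jump m h g-just g-nothing
    with Relabelling.later-head {false} {p} {s} g g-just g-nothing true m
  ... | _ , _ , eqc , 2<c , _ = trans
    (cong (map (map g)) (slide-row-corner (later-none false h) eqc 2<c))
    (cong₂ _∷_
      (cong₂ _∷_ g-2
        (trans (cong₂ _∷_ g-d (g-later-none false h)) (sym (jump-same false refl h))))
      (trans (map-lower g (map just (later true)) nothing)
             (cong₂ lower (trans (g-later true) (sym (jump-positions true)))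
                          (trans g-nothing (sym jump-d)))))
    where open Relabelling {false} {p} {s} g g-just g-nothing

  relabel-column-turn : Mixed p → Correct true (p , s ∷ʳ true)
  relabel-column-turn m g-just g-nothing
    with Relabelling.later-head {true} {p} {s} g g-just g-nothing false (m false)
       | Relabelling.later-head {true} {p} {s} g g-just g-nothing true (m true)
  ... | _ , _ , eqr , 2<x , _ | _ , _ , eqc , _ , c<d = trans
    (cong (map (map g)) (slide-first-column eqr 2<x eqc c<d))
    (cong₂ _∷_
      (cong₂ _∷_ g-2 (trans (g-later false) (sym turn-other)))
      (trans (map-lower g (map just (later true) ∷ʳ nothing) (just d))
             (cong₂ lower
               (trans (map-++ g (map just (later true)) _)
                      (trans (cong₂ _∷ʳ_ (g-later true) g-nothing) (sym turn-same)))
               g-d)))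
    where open Relabelling {true} {p} {s} g g-just g-nothing

  relabel-column-jump : false ∈ p → All (_≡ false) p → Correct true (p ++ true ∷ s , [])
  relabel-column-jump m h g-just g-nothing
    with Relabelling.later-head {true} {p} {s} g g-just g-nothing false m
  ... | _ , _ , eqr , 2<x , _ = trans
    (cong (map (map g)) (slide-column-corner eqr 2<x (later-none true h)))
    (cong₂ _∷_
      (cong₂ _∷_ g-2 (trans (g-later false) (sym (jump-positions false))))
      (trans (map-lower g (just d ∷ map just (later true)) nothing)
             (cong₂ lower
               (trans (cong₂ _∷_ g-d (g-later-none true h)) (sym (jump-same true refl h)))
               (trans g-nothing (sym jump-d)))))
    where open Relabelling {true} {p} {s} g g-just g-nothing

-- Keeps only what the four slides need of the relabelling: since the entries are exactly 1 to `n`,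
-- it lowers each by one and fills the empty box with `n`.
promotion-relabels : ∀ {T n} → 1 ≤ n → All (_≤ n) (entries T) →
  (∀ {i} → 1 ≤ i → i ≤ n → i ∈ entries T) →
  ∃ λ (g : Maybe ℕ → ℕ) → promotion T ≡ map (map g) (removeTopLeft T) ×
    (∀ {i} → 2 ≤ i → i ≤ n → g (just i) ≡ pred i) × g nothing ≡ n
promotion-relabels {T} 1≤n sound complete =
  maybe′ (predecessor T) (max 0 (entries T)) , refl ,
  predecessor-pred {T} sound complete , max-entries {T} sound complete 1≤n

-- Promotion as a step on words

promotion-turn : ∀ x {p} s → Mixed (x ∷ p) → Mixed p →
                 promotion (tableau (x ∷ p , s)) ≡ tableau (p , s ∷ʳ x)
promotion-turn x {p} s m m′
  with promotion-relabels {tableau (x ∷ p , s)} (s≤s z≤n) (tableau-sound {s = s} m) (tableau-complete {s = s} m)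
promotion-turn true  s m m′ | g , eq , g-just , g-nothing =
  trans eq (relabel-column-turn {s = s} g m′ g-just g-nothing)
promotion-turn false s m m′ | g , eq , g-just , g-nothing =
  trans eq (relabel-row-turn {s = s} g m′ g-just g-nothing)

promotion-jump : ∀ x {p} s → Mixed (x ∷ p) → All (_≡ not x) p →
                 promotion (tableau (x ∷ p , s)) ≡ tableau (p ++ x ∷ s , [])
promotion-jump x {p} s m h
  with promotion-relabels {tableau (x ∷ p , s)} (s≤s z≤n) (tableau-sound {s = s} m) (tableau-complete {s = s} m) | m (not x)
promotion-jump true  s m h | g , eq , g-just , g-nothing | there k =
  trans eq (relabel-column-jump {s = s} g k h g-just g-nothing)
promotion-jump false s m h | g , eq , g-just , g-nothing | there k =
  trans eq (relabel-row-jump {s = s} g k h g-just g-nothing)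

promotion-tableau : ∀ p s → Mixed p → promotion (tableau (p , s)) ≡ tableau (step (p , s))
promotion-tableau []      s m with m true
... | ()
promotion-tableau (x ∷ p) s m = case all? (Bool._≟ not x) p of λ where
  (yes h) → trans (promotion-jump x s m h) (cong tableau (sym (step-jump s h)))
  (no ¬h) → trans (promotion-turn x s m (Mixed-tail m ¬h)) (cong tableau (sym (step-turn s (Mixed-tail m ¬h))))

step-Mixed : ∀ p s → Mixed p → Mixed (proj₁ (step (p , s)))
step-Mixed [] s m = m
step-Mixed (x ∷ p) s m with all? (Bool._≟ not x) p
... | no ¬h = Mixed-tail m ¬h
... | yes _ = λ b → ∈-++⁺ʳ-∷ b
  where
  ∈-++⁺ʳ-∷ : ∀ b → b ∈ p ++ x ∷ s
  ∈-++⁺ʳ-∷ b with m b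
  ... | here refl = ∈-++⁺ʳ p (here refl)
  ... | there k   = ∈-++⁺ˡ k

fold-promotion : ∀ {p s} → Mixed p → ∀ t →
  fold (tableau (p , s)) promotion t ≡ tableau (fold (p , s) step t) × Mixed (proj₁ (fold (p , s) step t))
fold-promotion m zero    = refl , m
fold-promotion {p} {s} m (suc t) with fold-promotion {p} {s} m t
... | eq , m′ = trans (cong promotion eq) (promotion-tableau _ _ m′) , step-Mixed _ _ m′

-- The cyclic order on 2,…,n

module _ {A : Set} (f : A → A) where

  advance-+ : ∀ x a b → advance f x (a + b) ≡ advance f (advance f x a) b
  advance-+ x zero    b = refl
  advance-+ x (suc a) b = advance-+ (f x) a b

  advance-suc : ∀ x a → advance f x (suc a) ≡ f (advance f x a)
  advance-suc x a = trans (cong (advance f x) (+-comm 1 a)) (advance-+ x a 1)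

  iterate-+ : ∀ x a b → iterate f x (a + b) ≡ iterate f x a ++ iterate f (advance f x a) b
  iterate-+ x zero    b = refl
  iterate-+ x (suc a) b = cong (x ∷_) (iterate-+ (f x) a b)

  iterate-∷ʳ : ∀ x a → iterate f x (suc a) ≡ iterate f x a ∷ʳ advance f x a
  iterate-∷ʳ x a = trans (cong (iterate f x) (+-comm 1 a)) (iterate-+ x a 1)

  last-iterate : ∀ x a → last (iterate f x (suc a)) ≡ just (advance f x a)
  last-iterate x zero    = refl
  last-iterate x (suc a) = last-iterate (f x) a

  ∈-iterate⁺ : ∀ x {k m} → k < m → advance f x k ∈ iterate f x m
  ∈-iterate⁺ x {zero}  (s≤s _) = here refl
  ∈-iterate⁺ x {suc k} (s≤s h) = there (∈-iterate⁺ (f x) h)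

  ∈-iterate⁻ : ∀ x {m y} → y ∈ iterate f x m → ∃ λ k → k < m × advance f x k ≡ y
  ∈-iterate⁻ x {suc m} (here refl) = 0 , s≤s z≤n , refl
  ∈-iterate⁻ x {suc m} (there h) with ∈-iterate⁻ (f x) h
  ... | k , k<m , eq = suc k , s≤s k<m , eq

  -- Serves to show that a list from which an inner entry has been removed is no longer cyclically
  -- consecutive.
  iterate-consecutive : ∀ x m xs {y z ys} → iterate f x m ≡ xs ++ y ∷ z ∷ ys → z ≡ f y
  iterate-consecutive x (suc (suc m)) []       refl = refl
  iterate-consecutive x (suc m)       (_ ∷ xs) eq   =
    iterate-consecutive (f x) m xs (∷-injectiveʳ eq)

module Cyclic (N : ℕ) where

  n : ℕ
  n = suc N

  succ : ℕ → ℕ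
  succ = next n

  Range : ℕ → Set
  Range x = 2 ≤ x × x ≤ n

  succ-< : ∀ {x} → x < n → succ x ≡ suc x
  succ-< {x} x<n rewrite dec-false (x ≟ n) (<⇒≢ x<n) = refl

  succ-n : succ n ≡ 2
  succ-n rewrite dec-true (n ≟ n) refl = refl

  Range-succ : ∀ {x} → Range x → Range (succ x)
  Range-succ {x} (l , u) with m≤n⇒m<n∨m≡n u
  ... | inj₁ x<n rewrite succ-< x<n = ≤-trans l (n≤1+n x) , x<n
  ... | inj₂ refl rewrite succ-n = ≤-refl , l

  Range-advance : ∀ {x} k → Range x → Range (advance succ x k)
  Range-advance zero    r = r
  Range-advance (suc k) r = Range-advance k (Range-succ r)

  -- The last of the `k` entries is `x + k - 1`, so the bound is weaker by one than in
  -- `advance-plain`, which speaks of `x + k` itself.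
  iterate-plain : ∀ x k → x + k ≤ suc n → iterate succ x k ≡ iterate suc x k
  iterate-plain x zero          h = refl
  iterate-plain x (suc zero)    h = refl
  iterate-plain x (suc (suc k)) h = cong (x ∷_)
    (trans (cong (λ y → iterate succ y (suc k)) (succ-< (≤-trans (s≤s (m≤m+n x k)) (≤-pred h′))))
           (iterate-plain (suc x) (suc k) (≤-trans (s≤s (≤-reflexive (+-suc x k))) h′)))
    where
    h′ : suc (suc (x + k)) ≤ suc n
    h′ = ≤-trans (≤-reflexive (sym (trans (+-suc x (suc k)) (cong suc (+-suc x k))))) h

  advance-plain : ∀ x k → x + k ≤ n → advance succ x k ≡ x + k
  advance-plain x zero    h = sym (+-identityʳ x)
  advance-plain x (suc k) h rewrite +-suc x k | succ-< {x} (≤-trans (s≤s (m≤m+n x k)) h) =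
    advance-plain (suc x) k h

  -- Since `n` is followed by 2, passing it subtracts `N`, and `n + suc j` is `N + (2 + j)`.
  advance-wrap : ∀ x k j → x + k ≡ n + suc j → x ≤ n → 2 + j ≤ n → advance succ x k ≡ 2 + j
  advance-wrap x k j eq x≤n j≤ = begin
    advance succ x k                              ≡⟨ cong (advance succ x) k≡ ⟩
    advance succ x ((n ∸ x) + suc j)              ≡⟨ advance-+ succ x (n ∸ x) (suc j) ⟩
    advance succ (advance succ x (n ∸ x)) (suc j)
      ≡⟨ cong (λ y → advance succ y (suc j))
              (trans (advance-plain x (n ∸ x) (≤-reflexive (m+[n∸m]≡n x≤n))) (m+[n∸m]≡n x≤n)) ⟩
    advance succ (succ n) j                       ≡⟨ cong (λ y → advance succ y j) succ-n ⟩
    advance succ 2 j                              ≡⟨ advance-plain 2 j j≤ ⟩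
    2 + j ∎
    where
    k≡ : k ≡ (n ∸ x) + suc j
    k≡ = +-cancelˡ-≡ x k _ (trans eq (trans (cong (_+ suc j) (sym (m+[n∸m]≡n x≤n))) (+-assoc x (n ∸ x) (suc j))))

  -- Because `δ` is at most `N`, a walk that passes `n` ends at or before `x`, which is the second
  -- branch of `cyclicDifference`; a full turn, ending at `x`, falls under it too.
  cyclicDifference-advance : ∀ {x} δ → Range x → 1 ≤ δ → δ ≤ N →
    cyclicDifference n x (advance succ x δ) ≡ δ
  cyclicDifference-advance {x} δ (l , u) 1≤δ δ≤N with x + δ ≤? n
  ... | yes h rewrite advance-plain x δ h | <ᵇ-true {x} {x + δ} (m<m+n x 1≤δ) = m+n∸m≡n x δ
  ... | no ¬h with m≤n⇒∃[o]m+o≡n (≰⇒> ¬h)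
  ...   | j , eq = go
    where
    eq′ : x + δ ≡ n + suc j
    eq′ = trans (sym eq) (sym (+-suc n j))
    2+j≤x : 2 + j ≤ x
    2+j≤x = +-cancelʳ-≤ N (2 + j) x (≤-trans (≤-reflexive (trans (cong (2 +_) (+-comm j N)) eq)) (+-monoʳ-≤ x δ≤N))
    go : cyclicDifference n x (advance succ x δ) ≡ δ
    go rewrite advance-wrap x δ j eq′ u (≤-trans 2+j≤x u) | <ᵇ-false {x} {2 + j} 2+j≤x
      = trans (cong (_∸ x) (trans (cong (2 +_) (+-comm j N)) eq)) (m+n∸m≡n x δ)

  -- Two increasing lists without common entries: from this come both the distinctness of the
  -- circle's entries and the reading of the word from just after `D`.
  circle-split : ∀ x → 2 + x ≤ n → iterate succ (2 + x) N ≡ iterate suc (2 + x) (N ∸ x) ++ iterate suc 2 x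
  circle-split x (s≤s u) = begin
    iterate succ (2 + x) N ≡⟨ cong (iterate succ (2 + x)) (m∸n+n≡m x≤N) ⟨
    iterate succ (2 + x) ((N ∸ x) + x) ≡⟨ iterate-+ succ (2 + x) (N ∸ x) x ⟩
    iterate succ (2 + x) (N ∸ x) ++ iterate succ (advance succ (2 + x) (N ∸ x)) x
      ≡⟨ cong₂ _++_ (iterate-plain (2 + x) (N ∸ x) (≤-reflexive (cong (2 +_) (m+[n∸m]≡n x≤N))))
                    (cong (λ y → iterate succ y x)
                          (advance-wrap (2 + x) (N ∸ x) 0
                            (trans (cong (2 +_) (m+[n∸m]≡n x≤N)) (cong suc (+-comm 1 N)))
                            (s≤s u) (s≤s (≤-trans (s≤s z≤n) u)))) ⟩
    iterate suc (2 + x) (N ∸ x) ++ iterate succ 2 x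
      ≡⟨ cong (iterate suc (2 + x) (N ∸ x) ++_) (iterate-plain 2 x (s≤s (≤-trans u (n≤1+n N)))) ⟩
    iterate suc (2 + x) (N ∸ x) ++ iterate suc 2 x ∎
    where
    x≤N : x ≤ N
    x≤N = ≤-trans (n≤1+n x) u

iterate-suc-bounds : ∀ a k → All (λ i → a ≤ i × i < a + k) (iterate suc a k)
iterate-suc-bounds a zero    = []
iterate-suc-bounds a (suc k) rewrite +-suc a k =
  (≤-refl , s≤s (m≤m+n a k)) ∷ All.map (λ (l , u) → <⇒≤ l , u) (iterate-suc-bounds (suc a) k)

iterate-suc-< : ∀ a k → AllPairs _<_ (iterate suc a k)
iterate-suc-< a zero    = []
iterate-suc-< a (suc k) = All.map proj₁ (iterate-suc-bounds (suc a) k) ∷ iterate-suc-< (suc a) k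

Unique-++-disjoint : ∀ {A : Set} (xs : List A) {ys x} → Unique (xs ++ ys) → x ∈ xs → x ∈ ys → ⊥
Unique-++-disjoint (x ∷ xs) (h ∷ u) (here refl) k = All.lookup h (∈-++⁺ʳ xs k) refl
Unique-++-disjoint (x ∷ xs) (h ∷ u) (there j)   k = Unique-++-disjoint xs u j k

Unique-resp-↭ : ∀ {A : Set} {xs ys : List A} → xs ↭ ys → Unique xs → Unique ys
Unique-resp-↭ {A} = ↭ₛ.Unique-resp-↭ ∘ ↭⇒↭ₛ
  where import Data.List.Relation.Binary.Permutation.Setoid.Properties (setoid A) as ↭ₛ

-- Runs, gaps and blocks

alternating : Bool → List (ℕ × ℕ) → List Bool
alternating x []            = []
alternating x ((a , b) ∷ L) = replicate a (not x) ++ replicate b x ++ alternating x L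

Blocks-append₂ : ∀ {x k y u} → Blocks x k y u → ∀ b c →
  Blocks x (2 + k) y ((u ++ y ∷ replicate (suc b) (not y)) ++ not y ∷ replicate (suc c) y)
Blocks-append₂ {x} {k} {y} {u} B b c =
  subst (λ z → Blocks x (2 + k) z ((u ++ y ∷ replicate (suc b) (not y)) ++ not y ∷ replicate (suc c) z))
        (Bool.not-involutive y) (append (append B b) c)

-- In `Blocks` the current block always lacks its last letter. Accordingly one letter of each block
-- is moved from its front to its end, where it becomes the missing one, and the `x` in front closes
-- the block before.
Blocks-alternating : ∀ {x k u} → Blocks x k x u → ∀ {L} → All (λ (a , b) → 2 ≤ a × 2 ≤ b) L → ∀ w →
  ∃ λ u′ → u ++ x ∷ alternating x L ++ w ≡ u′ ++ x ∷ w × Blocks x (k + 2 * length L) x u′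
Blocks-alternating {x} {k} {u} B [] w = u , refl , subst (λ k → Blocks x k x u) (sym (+-identityʳ k)) B
Blocks-alternating {x} {k} {u} B {(suc (suc a) , suc (suc b)) ∷ L} ((s≤s (s≤s _) , s≤s (s≤s _)) ∷ h) w
  with Blocks-alternating (Blocks-append₂ B a b) h w
... | u′ , eq , B′ = u′ , trans shape′ eq , subst (λ k → Blocks x k x u′) (count k (length L)) B′
  where
  count : ∀ k l → 2 + k + 2 * l ≡ k + 2 * suc l
  count = solve-∀
  A  = replicate (suc a) (not x)
  B₁ = replicate (suc b) x
  V  = alternating x L
  shape′ : u ++ x ∷ (replicate (2 + a) (not x) ++ replicate (2 + b) x ++ V) ++ w ≡
           ((u ++ x ∷ A) ++ not x ∷ B₁) ++ x ∷ V ++ w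
  shape′ = begin
    u ++ x ∷ (not x ∷ A ++ x ∷ B₁ ++ V) ++ w ≡⟨ cong (λ l → u ++ x ∷ l ++ w) (replicate-∷ (suc a) (not x) _) ⟩
    u ++ x ∷ (A ++ not x ∷ x ∷ B₁ ++ V) ++ w ≡⟨ cong (λ l → u ++ x ∷ (A ++ not x ∷ l) ++ w) (replicate-∷ (suc b) x V) ⟩
    u ++ x ∷ (A ++ not x ∷ B₁ ++ x ∷ V) ++ w ≡⟨ cong (λ l → u ++ x ∷ l) (++-assoc A _ w) ⟩
    u ++ x ∷ A ++ not x ∷ (B₁ ++ x ∷ V) ++ w ≡⟨ cong (λ l → u ++ x ∷ A ++ not x ∷ l) (++-assoc B₁ (x ∷ V) w) ⟩
    u ++ x ∷ A ++ (not x ∷ B₁) ++ x ∷ V ++ w ≡⟨ ++-assoc u (x ∷ A) _ ⟨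
    (u ++ x ∷ A) ++ (not x ∷ B₁) ++ x ∷ V ++ w ≡⟨ ++-assoc (u ++ x ∷ A) (not x ∷ B₁) _ ⟨
    ((u ++ x ∷ A) ++ not x ∷ B₁) ++ x ∷ V ++ w ∎

Consecutive : ∀ {A : Set} → (A × A → Set) → A → List A → A → Set
Consecutive G x []       y = G (x , y)
Consecutive G x (z ∷ zs) y = G (x , z) × Consecutive G z zs y

cyclicPairs⇒Consecutive : ∀ {A : Set} {G : A × A → Set} x xs y →
  All G (zip (x ∷ xs) (xs ∷ʳ y)) → Consecutive G x xs y
cyclicPairs⇒Consecutive x []       y (g ∷ []) = g
cyclicPairs⇒Consecutive x (z ∷ zs) y (g ∷ h)  = g , cyclicPairs⇒Consecutive z zs y h

Consecutive-++⁺ : ∀ {A : Set} {G : A × A → Set} {x} xs {z zs y} →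
  Consecutive G x xs z → Consecutive G z zs y → Consecutive G x (xs ++ z ∷ zs) y
Consecutive-++⁺ []       g       h = g , h
Consecutive-++⁺ (_ ∷ xs) (g , k) h = g , Consecutive-++⁺ xs k h

Consecutive-++⁻ : ∀ {A : Set} {G : A × A → Set} {x} xs {z zs y} →
  Consecutive G x (xs ++ z ∷ zs) y → Consecutive G x xs z × Consecutive G z zs y
Consecutive-++⁻ []       (g , h) = g , h
Consecutive-++⁻ (_ ∷ xs) (g , k) with Consecutive-++⁻ xs k
... | k′ , h = (g , k′) , h

Segment : Set
Segment = Run × ℕ

segmentWord : List Segment → List Bool
segmentWord = concatMap (λ (R , g) → replicate (extent R) true ++ replicate g false)

-- i and j are the numbers of boxes, not counted by g, by which the
-- top-right entry widens the first and the last gap.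
Spaced : ℕ → ℕ → ℕ → List Segment → Set
Spaced i j g []             = 2 ≤ i + g + j
Spaced i j g ((R , g′) ∷ S) = 2 ≤ i + g × 2 ≤ extent R × Spaced 0 j g′ S

-- Groups each gap with the run after it, since here the word begins inside a run.
spaced-rotate : ∀ {i g} S → Spaced i 1 g S → i ≡ 0 →
  ∃₂ λ L a → replicate g false ++ segmentWord S ≡ alternating true L ++ replicate (suc a) false ×
             All (λ (a , b) → 2 ≤ a × 2 ≤ b) L × length L ≡ length S
-- `D` is one of the two boxes that the last gap needs, so only one further box is certain; as the
-- gap is next to `D`, one is enough.
spaced-rotate {g = zero}  [] (s≤s ()) refl
spaced-rotate {g = suc g} [] h refl = [] , g , ++-identityʳ _ , [] , refl
spaced-rotate {g = g} ((R , g′) ∷ S) (h₁ , h₂ , h) refl with spaced-rotate S h refl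
... | L , a , eq , hL , len = (g , extent R) ∷ L , a , shape′ , (h₁ , h₂) ∷ hL , cong suc len
  where
  E = replicate (extent R) true
  shape′ : replicate g false ++ (E ++ replicate g′ false) ++ segmentWord S ≡
           (replicate g false ++ E ++ alternating true L) ++ replicate (suc a) false
  shape′ = trans (cong (replicate g false ++_) (trans (++-assoc E _ _) (trans (cong (E ++_) eq) (sym (++-assoc E _ _)))))
                 (sym (++-assoc (replicate g false) _ _))

spaced-alternating : ∀ {i g} S → Spaced i 0 g S →
  2 ≤ i + g × All (λ (R , g) → 2 ≤ extent R × 2 ≤ g) S
spaced-alternating {i} {g} [] h = ≤-trans h (≤-reflexive (+-identityʳ (i + g))) , []
spaced-alternating ((R , g′) ∷ S) (h₁ , h₂ , h) with spaced-alternating S h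
... | h₃ , hS = h₁ , (h₂ , h₃) ∷ hS

segmentWord-alternating : ∀ S →
  segmentWord S ≡ alternating false (map (λ (R , g) → extent R , g) S)
segmentWord-alternating []            = refl
segmentWord-alternating ((R , g) ∷ S) =
  trans (++-assoc (replicate (extent R) true) _ _)
        (cong (λ l → replicate (extent R) true ++ replicate g false ++ l) (segmentWord-alternating S))

map-constant : ∀ {A B : Set} {f : A → B} {b xs} → All (λ x → f x ≡ b) xs → map f xs ≡ replicate (length xs) b
map-constant []         = refl
map-constant (refl ∷ h) = cong (_ ∷_) (map-constant h)

total : List Segment → ℕ
total = sum ∘ map (λ (R , g) → extent R + g)

-- Runs and gaps around the circle

module Chains (N : ℕ) where
  open Cyclic N

  gap : Segment → List ℕ
  gap (R , g) = iterate succ (advance succ (start R) (extent R)) g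

  Chain : ℕ → List Segment → ℕ → Set
  Chain q []            q′ = q ≡ q′
  Chain q ((R , g) ∷ S) q′ = start R ≡ q × Chain (advance succ q (extent R + g)) S q′

  Chain-++⁻ : ∀ {q} A {R g B q′} → Chain q (A ++ (R , g) ∷ B) q′ →
              Chain q A (start R) × Chain (start R) ((R , g) ∷ B) q′
  Chain-++⁻ []      (refl , c) = refl , refl , c
  Chain-++⁻ (_ ∷ A) (eq , c) with Chain-++⁻ A c
  ... | a , b = (eq , a) , b

  Chain-++⁺ : ∀ {q} A {B q′ q″} → Chain q A q′ → Chain q′ B q″ → Chain q (A ++ B) q″
  Chain-++⁺ []      refl     c = c
  Chain-++⁺ (_ ∷ A) (eq , a) c = eq , Chain-++⁺ A a c

  Chain-advance : ∀ {q} S {q′} → Chain q S q′ → advance succ q (total S) ≡ q′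
  Chain-advance []            c          = c
  Chain-advance {q} ((R , g) ∷ S) (_ , c) =
    trans (advance-+ succ q (extent R + g) (total S)) (Chain-advance S c)

  Chain-iterate : ∀ {q} S {q′} → Chain q S q′ →
    concatMap (λ X → elements n (proj₁ X) ++ gap X) S ≡ iterate succ q (total S)
  Chain-iterate []            c          = refl
  Chain-iterate {q} ((R , g) ∷ S) (refl , c) = sym (trans (iterate-+ succ q (extent R + g) (total S))
    (cong₂ _++_ (iterate-+ succ q (extent R) g) (sym (Chain-iterate S c))))

  elements-gaps-↭ : ∀ S → concatMap (λ X → elements n (proj₁ X) ++ gap X) S ↭
                          concatMap (elements n) (map proj₁ S) ++ concatMap gap S
  elements-gaps-↭ []      = ↭-refl
  elements-gaps-↭ (X ∷ S) = ↭-trans (↭.++⁺ˡ (E ++ G) (elements-gaps-↭ S))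
    (↭-trans (↭-reflexive (++-assoc E G _))
    (↭-trans (↭.++⁺ˡ E (↭.shifts G (concatMap (elements n) (map proj₁ S))))
             (↭-reflexive (sym (++-assoc E _ _)))))
    where
    E = elements n (proj₁ X)
    G = gap X

  ∈-concatMap : ∀ {A : Set} {f : A → List ℕ} {y x xs} → y ∈ f x → x ∈ xs → y ∈ concatMap f xs
  ∈-concatMap y∈ (here refl) = ∈-++⁺ˡ y∈
  ∈-concatMap {f = f} {xs = x ∷ _} y∈ (there h) = ∈-++⁺ʳ (f x) (∈-concatMap y∈ h)

  advance-to : ∀ {x q} → Range x → Range q → advance succ x ((q + N) ∸ x) ≡ q
  advance-to {x} {suc (suc q)} (_ , x≤n) (_ , q≤n) = advance-wrap x _ q
    (trans (m+[n∸m]≡n (≤-trans x≤n (s≤s (≤-trans (m≤n+m N q) (n≤1+n _)))))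
           (cong suc (trans (cong suc (+-comm q N)) (sym (+-suc N q)))))
    x≤n q≤n
  advance-to {x} {suc zero} _ (s≤s () , _)

  start∈ : ∀ {R} → IsRun n R → start R ∈ elements n R
  start∈ {run _ (suc _)} v = here refl
  start∈ {run _ zero} v with IsRun.2≤extent v
  ... | ()

  -- A gap is the distance to the next start less the extent. The subtraction does not truncate: a
  -- run reaching the next start would share it with the next run, against distinctness. `q₀` is the
  -- start of the first run, met again after a full turn, whence `q₀ + N`.
  close : ∀ {q₀} R Rs → Range q₀ → Linked _<_ (start R ∷ map start Rs) → All (IsRun n) (R ∷ Rs) →
    All (λ Q → extent Q ≤ (q₀ + N) ∸ start Q) (R ∷ Rs) → Unique (concatMap (elements n) (R ∷ Rs)) →
    ∃ λ S → map proj₁ S ≡ R ∷ Rs × Chain (start R) S q₀ × total S ≡ (q₀ + N) ∸ start R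
  close {q₀} R [] q₀-range _ (v ∷ []) (e≤m ∷ []) _ =
    (R , m ∸ extent R) ∷ [] , refl ,
    (refl , trans (cong (advance succ (start R)) (m+[n∸m]≡n e≤m))
                  (advance-to (IsRun.2≤start v , IsRun.start≤n v) q₀-range)) ,
    trans (+-identityʳ _) (m+[n∸m]≡n e≤m)
    where
    m = (q₀ + N) ∸ start R
  close {q₀} R (R′ ∷ Rs) q₀-range (s<s′ ∷ o) (v ∷ v′ ∷ vs) (_ ∷ es) uniq
    with close R′ Rs q₀-range o (v′ ∷ vs) es (AllPairs-++⁻ʳ (elements n R) uniq)
    where
    AllPairs-++⁻ʳ : ∀ xs {ys : List ℕ} → Unique (xs ++ ys) → Unique ys
    AllPairs-++⁻ʳ []       u       = u
    AllPairs-++⁻ʳ (_ ∷ xs) (_ ∷ u) = AllPairs-++⁻ʳ xs u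
  ... | S , eq , c , t =
    (R , δ ∸ extent R) ∷ S , cong (R ∷_) eq ,
    (refl , subst (λ q → Chain q S q₀) (sym (trans (cong (advance succ (start R)) e+g≡δ) advance≡)) c) ,
    trans (cong₂ _+_ e+g≡δ t) total≡
    where
    δ = start R′ ∸ start R
    s+δ≡s′ : start R + δ ≡ start R′
    s+δ≡s′ = m+[n∸m]≡n (<⇒≤ s<s′)
    advance≡ : advance succ (start R) δ ≡ start R′
    advance≡ = trans (advance-plain (start R) δ (≤-trans (≤-reflexive s+δ≡s′) (IsRun.start≤n v′))) s+δ≡s′
    e≤δ : extent R ≤ δ
    e≤δ = ≮⇒≥ λ δ<e → Unique-++-disjoint (elements n R) uniq
      (subst (_∈ elements n R) advance≡ (∈-iterate⁺ succ (start R) δ<e)) (∈-++⁺ˡ (start∈ v′))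
    e+g≡δ : extent R + (δ ∸ extent R) ≡ δ
    e+g≡δ = m+[n∸m]≡n e≤δ
    total≡ : δ + ((q₀ + N) ∸ start R′) ≡ (q₀ + N) ∸ start R
    total≡ = sym (trans (cong (_∸ start R) (sym s′+≡)) (trans (cong (_∸ start R) (+-assoc (start R) δ _)) (m+n∸m≡n (start R) _)))
      where
      s′+≡ : start R + δ + ((q₀ + N) ∸ start R′) ≡ q₀ + N
      s′+≡ = trans (cong (_+ ((q₀ + N) ∸ start R′)) s+δ≡s′)
        (m+[n∸m]≡n (≤-trans (IsRun.start≤n v′) (≤-trans (s≤s (m≤n+m N _)) (+-monoˡ-≤ N (≤-trans (s≤s (z≤n {1})) (proj₁ q₀-range))))))

  -- A run may wrap from `n` to 2, but it stops before it reaches `start R`, which already belongs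
  -- to `R`. This gives the bounds on the extents that `close` assumes.
  close-circle : ∀ R Rs → Linked _<_ (start R ∷ map start Rs) → All (IsRun n) (R ∷ Rs) →
    Unique (concatMap (elements n) (R ∷ Rs)) →
    ∃ λ S → map proj₁ S ≡ R ∷ Rs × Chain (start R) S (start R) × total S ≡ N
  close-circle R Rs o (v ∷ vs) uniq
    with close R Rs R-range o (v ∷ vs)
           (≤-trans (IsRun.extent≤n-1 v) (≤-reflexive (sym (m+n∸m≡n (start R) N))) ∷ All.tabulate bound) uniq
    where
    R-range : Range (start R)
    R-range = IsRun.2≤start v , IsRun.start≤n v
    bound : ∀ {Q} → Q ∈ Rs → extent Q ≤ (start R + N) ∸ start Q
    bound {Q} Q∈Rs = ≮⇒≥ λ m<e → Unique-++-disjoint (elements n R) uniq (start∈ v)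
      (∈-concatMap (subst (_∈ elements n Q) (advance-to (IsRun.2≤start w , IsRun.start≤n w) R-range)
                          (∈-iterate⁺ succ (start Q) m<e))
                   Q∈Rs)
      where
      w = All.lookup vs Q∈Rs
  ... | S , eq , c , t = S , eq , c , trans t (m+n∸m≡n (start R) N)

-- The circle is cut open just after d, the position of D, so R is the run of d.
module Cut {N : ℕ} {T : Tableau} {d : ℕ}
  (d-range : Cyclic.Range N d)
  (entries⊆ : ∀ {x} → x ∈ entries T → x ≢ d → x ∈ firstColumn T)
  (column⊆ : ∀ {x} → x ∈ firstColumn T → x ∈ entries T)
  (d∉ : ¬ d ∈ firstColumn T)
  (unique : Unique (entries T))
  {R : Run} {g : ℕ} {S : List Segment}
  (chain : Chains.Chain N (start R) ((R , g) ∷ S) (start R))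
  (total≡N : total ((R , g) ∷ S) ≡ N)
  (partition : concatMap (elements (suc N)) (R ∷ map proj₁ S) ↭ entries T)
  (valid : All (IsRun (suc N)) (R ∷ map proj₁ S))
  (gaps : Consecutive (GapAtLeast3 (suc N) T) R (map proj₁ S) R)
  (d∈R : d ∈ elements (suc N) R)
  (block : ∃₂ λ s k → firstColumnPart (suc N) T R ≡ iterate (next (suc N)) s k)
  where

  open Cyclic N
  open Chains N

  inColumn : ℕ → Bool
  inColumn i = does (i ∈? firstColumn T)

  runs : List Run
  runs = R ∷ map proj₁ S

  R-valid : IsRun n R
  R-valid = All.head valid

  R-range : Range (start R)
  R-range = IsRun.2≤start R-valid , IsRun.start≤n R-valid

  Unique-circle : ∀ {x} → Range x → Unique (iterate succ x N)
  Unique-circle {suc zero} (s≤s () , _)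
  Unique-circle {suc (suc x)} (l , u) rewrite circle-split x u = Unique.++⁺
    (AllPairs.map <⇒≢ (iterate-suc-< (2 + x) (N ∸ x))) (AllPairs.map <⇒≢ (iterate-suc-< 2 x))
    (λ (i , j) → <⇒≱ (proj₂ (All.lookup (iterate-suc-bounds 2 x) j))
                      (proj₁ (All.lookup (iterate-suc-bounds (2 + x) (N ∸ x)) i)))

  unique-runs : Unique (concatMap (elements n) runs)
  unique-runs = Unique-resp-↭ (↭-sym partition) unique

  -- Runs and gaps together go through the circle exactly once. Hence no position in a gap lies in a
  -- run, and its letter is `false`.
  unique-segments : Unique (concatMap (elements n) runs ++ concatMap gap ((R , g) ∷ S))
  unique-segments = Unique-resp-↭ (elements-gaps-↭ ((R , g) ∷ S))
    (subst Unique (sym (trans (Chain-iterate ((R , g) ∷ S) chain) (cong (iterate succ (start R)) total≡N)))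
           (Unique-circle R-range))

  inColumn-run : ∀ {Q x} → Q ∈ runs → x ∈ elements n Q → x ≢ d → x ∈ firstColumn T
  inColumn-run Q∈ x∈ = entries⊆ (↭.∈-resp-↭ partition (∈-concatMap x∈ Q∈))

  inColumn-gap : ∀ {X x} → X ∈ (R , g) ∷ S → x ∈ gap X → ¬ x ∈ firstColumn T
  inColumn-gap X∈ x∈ x∈col = Unique-++-disjoint (concatMap (elements n) runs) unique-segments
    (↭.∈-resp-↭ (↭-sym partition) (column⊆ x∈col)) (∈-concatMap x∈ X∈)

  d∉S : ∀ {Q} → Q ∈ map proj₁ S → ¬ d ∈ elements n Q
  d∉S Q∈ d∈Q = Unique-++-disjoint (elements n R) unique-runs d∈R (∈-concatMap d∈Q Q∈)

  S-inColumn : ∀ {Q} → Q ∈ map proj₁ S → All (_∈ firstColumn T) (elements n Q)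
  S-inColumn {Q} Q∈ = All.tabulate λ x∈ → inColumn-run (there Q∈) x∈ λ { refl → d∉S Q∈ x∈ }

  map-inColumn-true : ∀ {xs} → All (_∈ firstColumn T) xs → map inColumn xs ≡ replicate (length xs) true
  map-inColumn-true = map-constant ∘ All.map (dec-true (_ ∈? _))

  map-inColumn-gap : ∀ {X} → X ∈ (R , g) ∷ S → map inColumn (gap X) ≡ replicate (proj₂ X) false
  map-inColumn-gap {Q , h} X∈ = trans
    (map-constant (All.tabulate λ {x} x∈ → dec-false (x ∈? firstColumn T) (inColumn-gap X∈ x∈)))
    (cong (λ l → replicate l false) (length-iterate succ _ h))

  map-inColumn-S : ∀ S′ → (∀ {X} → X ∈ S′ → X ∈ S) →
    map inColumn (concatMap (λ X → elements n (proj₁ X) ++ gap X) S′) ≡ segmentWord S′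
  map-inColumn-S []            _ = refl
  map-inColumn-S ((Q , h) ∷ S′) ⊆S = trans (map-++ inColumn (elements n Q ++ gap (Q , h)) _)
    (cong₂ _++_
      (trans (map-++ inColumn (elements n Q) _)
        (cong₂ _++_
          (trans (map-inColumn-true (S-inColumn (∈-map⁺ proj₁ (⊆S (here refl)))))
                 (cong (λ l → replicate l true) (length-iterate succ (start Q) (extent Q))))
          (map-inColumn-gap (there (⊆S (here refl))))))
      (map-inColumn-S S′ (⊆S ∘ there)))

  extent+gap≤N : ∀ {X} → X ∈ (R , g) ∷ S → extent (proj₁ X) + proj₂ X ≤ N
  extent+gap≤N X∈ = ≤-trans (go X∈) (≤-reflexive total≡N)
    where
    go : ∀ {X S′} → X ∈ S′ → extent (proj₁ X) + proj₂ X ≤ total S′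
    go (here refl) = m≤m+n _ _
    go {S′ = Y ∷ _} (there h) = ≤-trans (go h) (m≤n+m _ (extent (proj₁ Y) + proj₂ Y))

  gap-bound : ∀ {X} → X ∈ (R , g) ∷ S → 2 + proj₂ X ≤ N
  gap-bound {Q , h} X∈ = ≤-trans (+-monoˡ-≤ h (IsRun.2≤extent (All.lookup valid (∈-map⁺ proj₁ X∈)))) (extent+gap≤N X∈)

  -- The gap condition only knows a representative modulo `N`; it is the actual distance because
  -- that lies between 1 and `N`.
  gap-lower : ∀ {Q Q′ a} δ → Range a → 1 ≤ δ → δ ≤ N → last (firstColumnPart n T Q) ≡ just a →
    head (firstColumnPart n T Q′) ≡ just (advance succ a δ) → GapAtLeast3 n T (Q , Q′) → 3 ≤ δ
  gap-lower δ r 1≤δ δ≤N la hb (a′ , b′ , la′ , hb′ , h)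
    rewrite just-injective (trans (sym la′) la) | just-injective (trans (sym hb′) hb) =
    ≤-trans h (≤-reflexive (cyclicDifference-advance δ r 1≤δ δ≤N))

  -- From the last column entry `a` of `Q` to the first one of the next run there are `i` boxes of
  -- `D`, `h` boxes of the gap and, when the next run is `R` again, `j` boxes of `D`. A difference
  -- of at least 3 leaves at least two boxes in between. `D` is at only one end of its run, so
  -- `i + j` is at most 1, and with `2 + h ≤ N` every distance stays within a turn.
  spaced : ∀ i j {a q Q h} S′ → (∀ {X} → X ∈ S′ → X ∈ S) → i + j ≤ 1 → 2 + h ≤ N → Range a →
    last (firstColumnPart n T Q) ≡ just a → advance succ a (suc (i + h)) ≡ q → Chain q S′ (start R) →
    head (firstColumnPart n T R) ≡ just (advance succ (start R) j) →
    Consecutive (GapAtLeast3 n T) Q (map proj₁ S′) R → Spaced i j h S′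
  spaced i j {a} {Q = Q} {h} [] _ i+j≤1 h≤N r la refl start≡ hd gp = ≤-pred (gap-lower {Q} {R} {a} (suc (i + h) + j) r (s≤s z≤n)
    (≤-trans (≤-trans (≤-reflexive (rearrange i h j)) (s≤s (+-monoˡ-≤ h i+j≤1))) h≤N) la
    (trans hd (cong just (trans (cong (λ q → advance succ q j) (sym start≡)) (sym (advance-+ succ a (suc (i + h)) j))))) gp)
    where
    rearrange : ∀ i h j → suc (i + h) + j ≡ suc (i + j + h)
    rearrange = solve-∀
  spaced i j {a} {q} {Q} {h} ((Q′@(run _ e) , h′) ∷ S′) ⊆S i+j≤1 h≤N r la refl (refl , ch) hd (gp , gps)
    with All.lookup valid (there (∈-map⁺ proj₁ (⊆S (here refl)))) | S-inColumn {Q′} (∈-map⁺ proj₁ (⊆S (here refl)))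
  ... | v | col with e | IsRun.2≤extent v
  ...   | suc zero    | s≤s ()
  ...   | suc (suc e) | e≥2 =
    ≤-pred (gap-lower {Q} {run q (2 + e)} {a} (suc (i + h)) r (s≤s z≤n)
      (≤-trans (s≤s (+-monoˡ-≤ h (≤-trans (m≤m+n i j) i+j≤1))) h≤N) la
      (cong head part) gp) ,
    e≥2 ,
    spaced 0 j {advance succ q (suc e)} {Q = run q (2 + e)} S′ (⊆S ∘ there) (≤-trans (m≤n+m j i) i+j≤1)
      (gap-bound (there (⊆S (here refl)))) (Range-advance (suc e) (Range-advance (suc (i + h)) r))
      (trans (cong last part) (last-iterate succ q (suc e)))
      (trans (sym (advance-+ succ q (suc e) (suc h′))) (cong (advance succ q) (+-suc (suc e) h′)))
      ch hd gps
    where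
    part : firstColumnPart n T (run q (2 + e)) ≡ iterate succ q (2 + e)
    part = filter-all (_∈? firstColumn T) col

  -- The word s p read from just after D, cut before its last block.
  Conclusion : Set
  Conclusion = ∃₂ λ x u → ∃ λ a →
    map inColumn (iterate succ (succ d) (N ∸ 1)) ≡ u ++ x ∷ replicate (suc a) (not x) ×
    Blocks x (2 * length S) x u

  segmentWord-S : map inColumn (concatMap (λ X → elements n (proj₁ X) ++ gap X) S) ≡ segmentWord S
  segmentWord-S = map-inColumn-S S (λ X∈ → X∈)

  module Split (pre post : List ℕ) (elements≡ : elements n R ≡ pre ++ d ∷ post) where

    unique-R : Unique (pre ++ d ∷ post)
    unique-R = subst Unique elements≡ (prefix (elements n R) unique-runs)
      where
      prefix : ∀ (xs : List ℕ) {ys} → Unique (xs ++ ys) → Unique xs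
      prefix []       u       = []
      prefix (x ∷ xs) (h ∷ u) = All.++⁻ˡ xs h ∷ prefix xs u

    in-R : ∀ {x} → x ∈ pre ++ d ∷ post → x ≢ d → x ∈ firstColumn T
    in-R x∈ = inColumn-run (here refl) (subst (_ ∈_) (sym elements≡) x∈)

    pre-inColumn : All (_∈ firstColumn T) pre
    pre-inColumn = All.tabulate λ x∈ → in-R (∈-++⁺ˡ x∈) λ { refl → Unique-++-disjoint pre unique-R x∈ (here refl) }

    post-inColumn : All (_∈ firstColumn T) post
    post-inColumn = All.tabulate λ x∈ → in-R (∈-++⁺ʳ pre (there x∈)) λ { refl → All.lookup (d∉post pre unique-R) x∈ refl }
      where
      d∉post : ∀ xs → Unique (xs ++ d ∷ post) → All (d ≢_) post
      d∉post []       (h ∷ _) = h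
      d∉post (_ ∷ xs) (_ ∷ u) = d∉post xs u

    part≡ : firstColumnPart n T R ≡ pre ++ post
    part≡ = trans (cong (filter (_∈? firstColumn T)) elements≡)
      (trans (filter-++ (_∈? firstColumn T) pre (d ∷ post))
        (cong₂ _++_ (filter-all (_∈? firstColumn T) pre-inColumn)
          (trans (filter-reject (_∈? firstColumn T) d∉) (filter-all (_∈? firstColumn T) post-inColumn))))

  inColumn-iterate : ∀ x k → All (_∈ firstColumn T) (iterate succ x k) →
                     map inColumn (iterate succ x k) ≡ replicate k true
  inColumn-iterate x k h = trans (map-inColumn-true h) (cong (λ l → replicate l true) (length-iterate succ x k))

  module _ (g-bound : 2 + g ≤ N) where

    -- The word after `D` opens with the rest of its run, so `x` is `true`, and closes with the gap
    -- before `D`. One letter of the first block is the one that `Blocks` leaves out, hence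
    -- `single e` for `suc e` letters.
    d-first : ∀ e → start R ≡ d → extent R ≡ 2 + e → Conclusion
    d-first e refl refl with spaced-rotate S
        (spaced 0 1 {advance succ d (suc e)} {Q = R} S (λ X∈ → X∈) ≤-refl g-bound (Range-advance (suc e) d-range)
          (trans (cong last part≡) (last-iterate succ (succ d) e))
          (trans (sym (advance-+ succ d (suc e) (suc g))) (cong (advance succ d) (+-suc (suc e) g)))
          (proj₂ chain) (cong head part≡) gaps) refl
      where open Split [] (iterate succ (succ d) (suc e)) refl
    ... | L , a , eq , hL , len with Blocks-alternating (single {true} e) hL (replicate (suc a) false)
    ...   | u , eq′ , B = true , u , a , trans word (trans word′ eq′) , subst (λ l → Blocks true (2 * l) true u) len B
      where
      open Split [] (iterate succ (succ d) (suc e)) refl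
      P = concatMap (λ X → elements n (proj₁ X) ++ gap X) S
      circle : d ∷ (iterate succ (succ d) (suc e) ++ gap (R , g)) ++ P ≡ iterate succ d N
      circle = trans (Chain-iterate ((R , g) ∷ S) chain) (cong (iterate succ d) total≡N)
      tail-circle : ∀ M {xs} → d ∷ xs ≡ iterate succ d M → xs ≡ iterate succ (succ d) (M ∸ 1)
      tail-circle (suc M) refl = refl
      word : map inColumn (iterate succ (succ d) (N ∸ 1)) ≡ (replicate (suc e) true ++ replicate g false) ++ segmentWord S
      word = trans (cong (map inColumn) (sym (tail-circle N circle)))
        (trans (map-++ inColumn (iterate succ (succ d) (suc e) ++ gap (R , g)) P)
          (cong₂ _++_ (trans (map-++ inColumn (iterate succ (succ d) (suc e)) (gap (R , g)))
                        (cong₂ _++_ (inColumn-iterate (succ d) (suc e) post-inColumn) (map-inColumn-gap (here refl))))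
                      segmentWord-S))
      word′ : (replicate (suc e) true ++ replicate g false) ++ segmentWord S ≡
              replicate e true ++ true ∷ alternating true L ++ replicate (suc a) false
      word′ = trans (++-assoc (replicate (suc e) true) _ _)
        (trans (cong (replicate (suc e) true ++_) eq) (replicate-∷ e true _))

    module LastInRun (e : ℕ) (d≡ : advance succ (start R) (suc e) ≡ d) (extent≡ : extent R ≡ 2 + e) where

      open Split (iterate succ (start R) (suc e)) []
        (trans (cong (iterate succ (start R)) extent≡)
               (trans (iterate-∷ʳ succ (start R) (suc e)) (cong (iterate succ (start R) (suc e) ∷ʳ_) d≡)))

      part≡′ : firstColumnPart n T R ≡ iterate succ (start R) (suc e)
      part≡′ = trans part≡ (++-identityʳ _)

      q : ℕ
      q = advance succ (start R) (2 + e + g)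

      chain-S : Chain q S (start R)
      chain-S = subst (λ l → Chain (advance succ (start R) (l + g)) S (start R)) extent≡ (proj₂ chain)

      spaced-S : 2 ≤ 1 + g × All (λ (R , g) → 2 ≤ extent R × 2 ≤ g) S
      spaced-S = spaced-alternating S
        (spaced 1 0 {advance succ (start R) e} {Q = R} S (λ X∈ → X∈) ≤-refl g-bound (Range-advance e R-range)
          (trans (cong last part≡′) (last-iterate succ (start R) e))
          (trans (sym (advance-+ succ (start R) e (2 + g)))
                 (cong (advance succ (start R)) (trans (+-suc e (suc g)) (cong suc (+-suc e g)))))
          chain-S (cong head part≡′) gaps)

      P : List ℕ
      P = concatMap (λ X → elements n (proj₁ X) ++ gap X) S

      rest-of-circle : iterate succ (succ d) (N ∸ 1) ≡ gap (R , g) ++ P ++ iterate succ (start R) (suc e)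
      rest-of-circle = begin
        iterate succ (succ d) (N ∸ 1)
          ≡⟨ cong (iterate succ (succ d)) N∸1≡ ⟩
        iterate succ (succ d) (g + (total S + suc e))
          ≡⟨ iterate-+ succ (succ d) g (total S + suc e) ⟩
        iterate succ (succ d) g ++ iterate succ (advance succ (succ d) g) (total S + suc e)
          ≡⟨ cong₂ (λ y z → iterate succ y g ++ iterate succ z (total S + suc e)) succ-d≡ q≡ ⟩
        gap (R , g) ++ iterate succ q (total S + suc e)
          ≡⟨ cong (gap (R , g) ++_) (iterate-+ succ q (total S) (suc e)) ⟩
        gap (R , g) ++ iterate succ q (total S) ++ iterate succ (advance succ q (total S)) (suc e)
          ≡⟨ cong₂ (λ l y → gap (R , g) ++ l ++ iterate succ y (suc e))
                   (sym (Chain-iterate S chain-S)) (Chain-advance S chain-S) ⟩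
        gap (R , g) ++ P ++ iterate succ (start R) (suc e) ∎
        where
        rearrange : ∀ e g t → suc e + g + t ≡ g + (t + suc e)
        rearrange = solve-∀
        N∸1≡ : N ∸ 1 ≡ g + (total S + suc e)
        N∸1≡ = trans (cong pred (sym total≡N))
          (trans (cong (λ l → pred (l + g + total S)) extent≡) (rearrange e g (total S)))
        advance-d : ∀ k → advance succ (succ d) k ≡ advance succ (start R) (2 + e + k)
        advance-d k = trans (cong (λ y → advance succ y (suc k)) (sym d≡))
          (trans (sym (advance-+ succ (start R) (suc e) (suc k))) (cong (advance succ (start R)) (+-suc (suc e) k)))
        succ-d≡ : succ d ≡ advance succ (start R) (extent R)
        succ-d≡ = trans (advance-d 0) (cong (advance succ (start R)) (trans (+-identityʳ (2 + e)) (sym extent≡)))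
        q≡ : advance succ (succ d) g ≡ q
        q≡ = advance-d g

      word : map inColumn (iterate succ (succ d) (N ∸ 1)) ≡
             replicate g false ++ segmentWord S ++ replicate (suc e) true
      word = trans (cong (map inColumn) rest-of-circle)
        (trans (map-++ inColumn (gap (R , g)) (P ++ iterate succ (start R) (suc e)))
          (cong₂ _++_ (map-inColumn-gap (here refl))
            (trans (map-++ inColumn P (iterate succ (start R) (suc e)))
              (cong₂ _++_ segmentWord-S (inColumn-iterate (start R) (suc e) pre-inColumn)))))

    -- Now the word opens with the gap after `D`, so `x` is `false`, and closes with the rest of the
    -- run of `D`.
    d-last : ∀ e → advance succ (start R) (suc e) ≡ d → extent R ≡ 2 + e → Conclusion
    d-last e d≡ extent≡ = finish (proj₁ spaced-S) word
      where
      open LastInRun e d≡ extent≡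
      finish : ∀ {g w} → 2 ≤ 1 + g → w ≡ replicate g false ++ segmentWord S ++ replicate (suc e) true →
        ∃₂ λ x u → ∃ λ a → w ≡ u ++ x ∷ replicate (suc a) (not x) × Blocks x (2 * length S) x u
      -- `D` is one of the two boxes between the neighbouring column entries, so the gap itself has
      -- at least one.
      finish {zero}  (s≤s ()) _
      finish {suc g} _ eq
        with Blocks-alternating (single {false} g) (All.map⁺ (proj₂ spaced-S)) (replicate (suc e) true)
      ... | u , eq′ , B = false , u , e ,
        trans eq (trans (replicate-∷ g false _)
          (trans (cong (λ l → replicate g false ++ false ∷ l ++ replicate (suc e) true) (segmentWord-alternating S)) eq′)) ,
        subst (λ l → Blocks false (2 * l) false u) (length-map _ S) B

  -- Could fail only for `n = 2`, a circle of one element, which has no room for a run of two.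
  succ-≢ : ∀ {x} → Range x → succ x ≢ x
  succ-≢ {x} (l , u) eq with m≤n⇒m<n∨m≡n u
  ... | inj₁ x<n = 1+n≢n (trans (sym (succ-< x<n)) eq)
  ... | inj₂ refl with trans (sym succ-n) eq
  ...   | refl = <⇒≱ (IsRun.2≤extent R-valid) (IsRun.extent≤n-1 R-valid)

  conclusion : Conclusion
  conclusion with ∈-iterate⁻ succ (start R) d∈R
  ... | i , i<e , eq with m≤n⇒∃[o]m+o≡n i<e
  ...   | m , eq′ = go i m eq (trans (sym eq′) (sym (+-suc i m)))
    where
    go : ∀ i m → advance succ (start R) i ≡ d → extent R ≡ i + suc m → Conclusion
    go zero zero _ e≡ = ⊥-elim (<⇒≢ (IsRun.2≤extent R-valid) (sym e≡))
    go zero (suc m) d≡ e≡ = d-first (gap-bound (here refl)) m d≡ e≡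
    go (suc i) zero d≡ e≡ = d-last (gap-bound (here refl)) i d≡ (trans e≡ (+-comm (suc i) 1))
    -- Strictly inside its run, `D` would make `y` and `succ d` neighbours in the column part. That
    -- part is cyclically consecutive by `block`, so `succ d` would be `succ y`, which is `d`.
    go (suc i) (suc m) d≡ e≡ = ⊥-elim (succ-≢ d-range
      (trans (iterate-consecutive succ s k (iterate succ (start R) i) {y} {succ d} (trans (sym part≡s,k) (trans part≡ pre++post)))
             (trans (sym (advance-suc succ (start R) i)) d≡)))
      where
      s = proj₁ block
      k = proj₁ (proj₂ block)
      part≡s,k = proj₂ (proj₂ block)
      y = advance succ (start R) i
      open Split (iterate succ (start R) (suc i)) (iterate succ (succ d) (suc m))
        (trans (cong (iterate succ (start R)) e≡)
          (trans (iterate-+ succ (start R) (suc i) (suc (suc m)))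
                 (cong (λ z → iterate succ (start R) (suc i) ++ iterate succ z (suc (suc m))) d≡)))
      pre++post : iterate succ (start R) (suc i) ++ iterate succ (succ d) (suc m) ≡
                  iterate succ (start R) i ++ y ∷ succ d ∷ iterate succ (succ (succ d)) m
      pre++post = trans (cong (_++ iterate succ (succ d) (suc m)) (iterate-∷ʳ succ (start R) i))
                        (++-assoc (iterate succ (start R) i) _ _)

concatMap-rotate-↭ : ∀ {A B : Set} (f : A → List B) xs ys → concatMap f (xs ++ ys) ↭ concatMap f (ys ++ xs)
concatMap-rotate-↭ f xs ys = ↭-trans (↭-reflexive (concatMap-++ f xs ys))
  (↭-trans (↭.++-comm (concatMap f xs) (concatMap f ys)) (↭-reflexive (sym (concatMap-++ f ys xs))))

cyclicPairs-rotate : ∀ {A : Set} {G : A × A → Set} xs {y} ys →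
  All G (cyclicPairs (xs ++ y ∷ ys)) → Consecutive G y (ys ++ xs) y
cyclicPairs-rotate []       {y} ys h rewrite ++-identityʳ ys = cyclicPairs⇒Consecutive y ys y h
cyclicPairs-rotate (x ∷ xs) {y} ys h with Consecutive-++⁻ xs (cyclicPairs⇒Consecutive x (xs ++ y ∷ ys) x h)
... | k , l = Consecutive-++⁺ ys l k

module _ {N : ℕ} where
  open Cyclic N
  open Chains N

  locate : ∀ {d} (S : List Segment) → d ∈ concatMap (elements n) (map proj₁ S) →
    ∃₂ λ A R → ∃₂ λ g B → S ≡ A ++ (R , g) ∷ B × d ∈ elements n R
  locate ((R , g) ∷ S) d∈ with ∈-++⁻ (elements n R) d∈
  ... | inj₁ h = [] , R , g , S , refl , h
  ... | inj₂ h with locate S h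
  ...   | A , R′ , g′ , B , refl , k = (R , g) ∷ A , R′ , g′ , B , refl , k

  total-++ : ∀ A B → total (A ++ B) ≡ total A + total B
  total-++ []            B = refl
  total-++ ((R , g) ∷ A) B = trans (cong (extent R + g +_) (total-++ A B)) (sym (+-assoc (extent R + g) _ _))

  -- The runs are rotated until that of `d` comes first, which is where the circle is cut. Each of
  -- the other `r ∸ 1` runs contributes two blocks, itself and a gap; the remaining two blocks are
  -- those next to `D`.
  HasRuns⇒Blocks : ∀ {r T d} → HasRuns n r T → Range d →
    (∀ {x} → x ∈ entries T → x ≢ d → x ∈ firstColumn T) →
    (∀ {x} → x ∈ firstColumn T → x ∈ entries T) →
    d ∈ entries T → ¬ d ∈ firstColumn T → Unique (entries T) →
    ∃₂ λ x u → ∃ λ a →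
      map (λ i → does (i ∈? firstColumn T)) (iterate succ (succ d) (N ∸ 1)) ≡ u ++ x ∷ replicate (suc a) (not x) ×
      Blocks x (2 * (r ∸ 1)) x u
  HasRuns⇒Blocks {T = T} {d} H d-range entries⊆ column⊆ d∈ d∉ unique
    with HasRuns.runs H | HasRuns.number H | HasRuns.valid H | HasRuns.ordered H
       | HasRuns.partition H | HasRuns.blocks H | HasRuns.gaps H
  ... | [] | _ | _ | _ | π | _ | _ = case ↭.∈-resp-↭ (↭-sym π) d∈ of λ ()
  ... | R₁ ∷ Rs | refl | valid | ordered | π | blocks | gaps
    with close-circle R₁ Rs ordered valid (Unique-resp-↭ (↭-sym π) unique)
  ...   | S₁ , runs≡ , chain , total≡
    with locate {d} S₁ (subst {A = List Run} (λ l → d ∈ concatMap (elements n) l) (sym runs≡) (↭.∈-resp-↭ (↭-sym π) d∈))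
  ...     | A , R , g , B , refl , d∈R =
    subst (λ l → ∃₂ λ x u → ∃ λ a → _ × Blocks x (2 * l) x u) count
      (Cut.conclusion {N} {T} {d} d-range entries⊆ column⊆ d∉ unique {R} {g} {B ++ A}
        (Chain-++⁺ ((R , g) ∷ B) (proj₂ (Chain-++⁻ A chain)) (proj₁ (Chain-++⁻ A chain)))
        (trans (total-++ ((R , g) ∷ B) A) (trans (+-comm _ (total A)) (trans (sym (total-++ A ((R , g) ∷ B))) total≡)))
        (subst (λ l → concatMap (elements n) (R ∷ l) ↭ entries T) (sym (map-++ proj₁ B A))
          (↭-trans (concatMap-rotate-↭ (elements n) (R ∷ map proj₁ B) (map proj₁ A))
                   (subst (λ l → concatMap (elements n) l ↭ entries T) runs≡′ π)))
        (subst (λ l → All (IsRun n) (R ∷ l)) (sym (map-++ proj₁ B A))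
          (All.++⁺ (All.++⁻ʳ (map proj₁ A) (subst (All (IsRun n)) runs≡′ valid))
                   (All.++⁻ˡ (map proj₁ A) (subst (All (IsRun n)) runs≡′ valid))))
        (subst (λ l → Consecutive (GapAtLeast3 n T) R l R) (sym (map-++ proj₁ B A))
          (cyclicPairs-rotate (map proj₁ A) (map proj₁ B) (subst (λ l → All (GapAtLeast3 n T) (cyclicPairs l)) runs≡′ gaps)))
        d∈R
        (All.head (All.++⁻ʳ (map proj₁ A) (subst (All _) runs≡′ blocks))))
    where
    runs≡′ : R₁ ∷ Rs ≡ map proj₁ A ++ R ∷ map proj₁ B
    runs≡′ = trans (sym runs≡) (map-++ proj₁ A ((R , g) ∷ B))
    count : length (B ++ A) ≡ length Rs
    count = suc-injective (trans (cong suc (trans (length-++ B) (+-comm (length B) (length A))))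
      (trans (sym (+-suc (length A) (length B)))
      (trans (sym (length-++ A {(R , g) ∷ B}))
      (trans (sym (length-map proj₁ (A ++ (R , g) ∷ B))) (cong length runs≡)))))

-- Least periods

module _ {A : Set} (_≟A_ : DecidableEquality A) (f : A → A) (x : A) where

  -- A bounded search; the period already known serves as the bound `m`.
  least-period : ∀ m →
    (∃ λ t → 1 ≤ t × fold x f t ≡ x × (∀ s → 1 ≤ s → fold x f s ≡ x → t ≤ s)) ⊎
    (∀ s → 1 ≤ s → s ≤ m → fold x f s ≢ x)
  least-period zero = inj₂ λ { (suc s) _ () }
  least-period (suc m) with least-period m
  ... | inj₁ found = inj₁ found
  ... | inj₂ none with fold x f (suc m) ≟A x
  ...   | yes eq = inj₁ (suc m , s≤s z≤n , eq , λ s 1≤s e → ≰⇒> λ s≤m → none s 1≤s s≤m e)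
  ...   | no ¬eq = inj₂ λ s 1≤s s≤ e → case m≤n⇒m<n∨m≡n s≤ of λ where
    (inj₁ s<) → none s 1≤s (≤-pred s<) e
    (inj₂ refl) → ¬eq e

  fold-multiple : ∀ {t} → fold x f t ≡ x → ∀ q → fold x f (q * t) ≡ x
  fold-multiple         eq zero    = refl
  fold-multiple {t = t} eq (suc q) = trans (fold-+ x f t) (trans (cong (λ y → fold y f t) (fold-multiple eq q)) eq)

  period-divides : ∀ {M} → 1 ≤ M → fold x f M ≡ x →
    ∃ λ t → (1 ≤ t × fold x f t ≡ x × (∀ s → 1 ≤ s → fold x f s ≡ x → t ≤ s)) × t ∣ M
  period-divides {M} 1≤M eq with least-period M
  ... | inj₂ none = ⊥-elim (none M 1≤M ≤-refl eq)
  ... | inj₁ (t@(suc _) , 1≤t , fixes , least) = t , (1≤t , fixes , least) , m%n≡0⇒n∣m M t (remainder (M % t) refl)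
    where
    fixed : fold x f (M % t) ≡ x
    fixed = trans (sym (trans (fold-+ x f (M % t) {(M / t) * t}) (cong (λ y → fold y f (M % t)) (fold-multiple fixes (M / t)))))
                  (trans (cong (fold x f) (sym (m≡m%n+[m/n]*n M t))) eq)
    remainder : ∀ k → M % t ≡ k → M % t ≡ 0
    remainder zero    e = e
    remainder (suc k) e = ⊥-elim (<⇒≱ (m%n<n M t) (least (M % t) (subst (1 ≤_) (sym e) (s≤s z≤n)) fixed))

-- The word of a near-hook

sorted-≡ : ∀ {xs ys} → AllPairs _<_ xs → AllPairs _<_ ys →
  (∀ {i} → i ∈ xs → i ∈ ys) → (∀ {i} → i ∈ ys → i ∈ xs) → xs ≡ ys
sorted-≡ []      []      _ _ = refl
sorted-≡ []      (_ ∷ _) _ g with g (here refl)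
... | ()
sorted-≡ (_ ∷ _) []      f _ with f (here refl)
... | ()
sorted-≡ {x ∷ xs} {y ∷ ys} (x< ∷ ps) (y< ∷ qs) f g = cong₂ _∷_ x≡y
  (sorted-≡ ps qs (λ h → narrow (All.lookup x< h) (f (there h)) (≤-reflexive (sym x≡y)))
                  (λ h → narrow (All.lookup y< h) (g (there h)) (≤-reflexive x≡y)))
  where
  head≤ : ∀ {i z zs} → i ∈ z ∷ zs → All (z <_) zs → z ≤ i
  head≤ (here refl) _ = ≤-refl
  head≤ (there h) z<  = <⇒≤ (All.lookup z< h)
  x≡y : x ≡ y
  x≡y = ≤-antisym (head≤ (g (here refl)) x<) (head≤ (f (here refl)) y<)
  narrow : ∀ {i w z zs} → w < i → i ∈ z ∷ zs → z ≤ w → i ∈ zs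
  narrow w<i (here refl) z≤w = ⊥-elim (<⇒≱ w<i z≤w)
  narrow _   (there h)   _   = h

positions-map : ∀ b (f : ℕ → Bool) k m →
  positions b k (map f (iterate suc k m)) ≡ filter (λ i → f i Bool.≟ b) (iterate suc k m)
positions-map b f k zero    = refl
positions-map b f k (suc m) with does (f k Bool.≟ b)
... | true  = cong (k ∷_) (positions-map b f (suc k) m)
... | false = positions-map b f (suc k) m

∈-[1⋯]⁻ : ∀ {i n} → i ∈ [1⋯ n ] → 1 ≤ i × i ≤ n
∈-[1⋯]⁻ h with ∈-map⁻ suc h
... | j , j∈ , refl = s≤s z≤n , ∈-upTo⁻ j∈

∈-[1⋯]⁺ : ∀ {i n} → 1 ≤ i → i ≤ n → i ∈ [1⋯ n ]
∈-[1⋯]⁺ {suc i} _ i<n = ∈-map⁺ suc (∈-upTo⁺ i<n)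

singleton-rows : ∀ k rows → map length rows ≡ replicate k 1 → ∃ λ (cs : List ℕ) → rows ≡ map (_∷ []) cs
singleton-rows zero    []               _  = [] , refl
singleton-rows (suc k) ((c ∷ []) ∷ rows) eq with singleton-rows k rows (∷-injectiveʳ eq)
... | cs , refl = c ∷ cs , refl

near-hook-shape : ∀ {n T} → IsNearHook n T → ∃₂ λ c d → ∃ λ cs → T ≡ lower (c ∷ cs) d
near-hook-shape {T = []} H with IsNearHook.shape-≡ H
... | ()
near-hook-shape {n} {T = row ∷ rows} H with ∷-injectiveʳ (IsNearHook.shape-≡ H)
... | eq with singleton-rows _ rows (∷-injectiveʳ eq)
near-hook-shape {T = (c ∷ d ∷ []) ∷ _} H | eq | cs , refl = c , d , cs , refl

prefix-of-row : ∀ {c d row} → Prefix _>_ (c ∷ d ∷ []) row →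
  ∃₂ λ a b → ∃ λ as → row ≡ a ∷ b ∷ as × a < c × b < d
prefix-of-row (a<c ∷ b<d ∷ _) = _ , _ , _ , refl , a<c , b<d

column-increasing : ∀ {c us} cs → Linked (λ upper lower → Prefix _>_ lower upper) ((c ∷ us) ∷ map (_∷ []) cs) →
  Linked _<_ (c ∷ cs)
column-increasing []        _              = [-]
column-increasing (c′ ∷ cs) ((c<c′ ∷ _) ∷ l) = c<c′ ∷ column-increasing cs l

firstColumn-singletons : ∀ cs → firstColumn (map (_∷ []) cs) ≡ cs
firstColumn-singletons []       = refl
firstColumn-singletons (c ∷ cs) = cong (c ∷_) (firstColumn-singletons cs)

module NearHook {N c e : ℕ} {cs : List ℕ} {T : Tableau}
  (T≡ : T ≡ lower (c ∷ cs) (2 + e))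
  (standard : IsStandard (suc N) (T [ suc N ])) (r : ℕ) (hasRuns : HasRuns (suc N) r T) where

  open Cyclic N
  open IsStandard standard

  d : ℕ
  d = 2 + e

  row : List ℕ
  row = filter (_∉? entries T) [1⋯ n ]

  inColumn : ℕ → Bool
  inColumn i = does (i ∈? firstColumn T)

  p s : List Bool
  p = map inColumn (iterate suc 2 e)
  s = map inColumn (iterate suc (3 + e) (N ∸ suc e))

  entries≡ : entries T ≡ c ∷ d ∷ cs
  entries≡ = trans (cong entries T≡) (cong (λ l → c ∷ d ∷ l) (concat-map-[ cs ]))

  firstColumn≡ : firstColumn T ≡ c ∷ cs
  firstColumn≡ = trans (cong firstColumn T≡) (cong (c ∷_) (firstColumn-singletons cs))

  ∈-entries⁻ : ∀ {i} → i ∈ entries T → i ≡ d ⊎ i ∈ firstColumn T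
  ∈-entries⁻ {i} h with subst (i ∈_) entries≡ h
  ... | here refl         = inj₂ (subst (i ∈_) (sym firstColumn≡) (here refl))
  ... | there (here refl) = inj₁ refl
  ... | there (there h′)  = inj₂ (subst (i ∈_) (sym firstColumn≡) (there h′))

  entries⊆ : ∀ {i} → i ∈ entries T → i ≢ d → i ∈ firstColumn T
  entries⊆ h i≢d with ∈-entries⁻ h
  ... | inj₁ i≡d = ⊥-elim (i≢d i≡d)
  ... | inj₂ k   = k

  column⊆ : ∀ {i} → i ∈ firstColumn T → i ∈ entries T
  column⊆ {i} h with subst (i ∈_) firstColumn≡ h
  ... | here refl = subst (i ∈_) (sym entries≡) (here refl)
  ... | there h′  = subst (i ∈_) (sym entries≡) (there (there h′))

  d∈ : d ∈ entries T
  d∈ = subst (d ∈_) (sym entries≡) (there (here refl))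

  unique : Unique (entries T)
  unique = suffix row (Unique-resp-↭ (↭-sym entries-1⋯n) (Unique.map⁺ suc-injective (Unique.upTo⁺ n)))
    where
    suffix : ∀ (xs : List ℕ) {ys} → Unique (xs ++ ys) → Unique ys
    suffix []       u       = u
    suffix (_ ∷ xs) (_ ∷ u) = suffix xs u

  d∉ : ¬ d ∈ firstColumn T
  d∉ h with subst Unique entries≡ unique | subst (d ∈_) firstColumn≡ h
  ... | (c≢ ∷ _) ∷ _  | here d≡c = c≢ (sym d≡c)
  ... | _ ∷ (d≢ ∷ _)  | there k  = All.lookup d≢ k refl

  entries-range : ∀ {i} → i ∈ entries T → 1 ≤ i × i ≤ n
  entries-range h = ∈-[1⋯]⁻ (↭.∈-resp-↭ entries-1⋯n (∈-++⁺ʳ row h))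

  rows-sorted : AllPairs _<_ row × c < d
  rows-sorted with subst (λ U → All (Linked _<_) (row ∷ U)) T≡ rows-increasing
  ... | r ∷ (c<d ∷ _) ∷ _ = Linked.Linked⇒AllPairs <-trans r , c<d

  column-sorted : AllPairs _<_ (c ∷ cs)
  column-sorted with subst (λ U → Linked (λ upper lower → Prefix _>_ lower upper) (row ∷ U)) T≡ columns-increasing
  ... | _ ∷ l = Linked.Linked⇒AllPairs <-trans (column-increasing cs l)

  row-start : ∃₂ λ a b → ∃ λ as → row ≡ a ∷ b ∷ as × a < c × b < d
  row-start with subst (λ U → Linked (λ upper lower → Prefix _>_ lower upper) (row ∷ U)) T≡ columns-increasing
  ... | q ∷ _ = prefix-of-row q

  row⁻ : ∀ {i} → i ∈ row → (1 ≤ i × i ≤ n) × ¬ i ∈ entries T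
  row⁻ h with ∈-filter⁻ (_∉? entries T) {xs = [1⋯ n ]} h
  ... | k , ∉ = ∈-[1⋯]⁻ k , ∉

  2≤c : 2 ≤ c
  2≤c with row-start
  ... | a , b , as , eq , a<c , _ = ≤-trans (s≤s (proj₁ (proj₁ (row⁻ (subst (a ∈_) (sym eq) (here refl)))))) a<c

  -- The witness is the box above the top-right entry of `T`. It is at least 2 because it exceeds
  -- the top-left entry.
  below-d : ∃ λ b → b ∈ row × 2 ≤ b × b < d
  below-d with row-start | rows-sorted
  ... | a , b , as , eq , _ , b<d | sorted , _ with subst (AllPairs _<_) eq sorted
  ...   | (a<b ∷ _) ∷ _ = b , subst (b ∈_) (sym eq) (there (here refl)) ,
    ≤-trans (s≤s (proj₁ (proj₁ (row⁻ (subst (a ∈_) (sym eq) (here refl)))))) a<b , b<d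

  column-range : ∀ {i} → i ∈ firstColumn T → 2 ≤ i × i ≤ n
  column-range {i} h = ≤-trans 2≤c (c≤ (subst (i ∈_) firstColumn≡ h)) , proj₂ (entries-range (column⊆ h))
    where
    c≤ : ∀ {i} → i ∈ c ∷ cs → c ≤ i
    c≤ (here refl) = ≤-refl
    c≤ (there k) with column-sorted
    ... | c< ∷ _ = <⇒≤ (All.lookup c< k)

  d≤n : d ≤ n
  d≤n = proj₂ (entries-range d∈)

  d-range : Range d
  d-range = s≤s (s≤s z≤n) , d≤n

  inColumn-true : ∀ {i} → inColumn i ≡ true → i ∈ firstColumn T
  inColumn-true {i} eq with i ∈? firstColumn T
  ... | yes h = h
  inColumn-true {i} () | no _

  inColumn-false : ∀ {i} → inColumn i ≡ false → ¬ i ∈ firstColumn T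
  inColumn-false {i} eq with i ∈? firstColumn T
  ... | no h = h
  inColumn-false {i} () | yes _

  ∈-iterate-suc : ∀ {i} a k → a ≤ i → i < a + k → i ∈ iterate suc a k
  ∈-iterate-suc a zero    l u rewrite +-identityʳ a = ⊥-elim (<⇒≱ u l)
  ∈-iterate-suc a (suc k) l u with m≤n⇒m<n∨m≡n l
  ... | inj₂ refl = here refl
  ... | inj₁ a<i  = there (∈-iterate-suc (suc a) k a<i (≤-trans u (≤-reflexive (+-suc a k))))

  Mixed-p : Mixed p
  Mixed-p true  = subst (_∈ p) (dec-true (c ∈? firstColumn T) (subst (c ∈_) (sym firstColumn≡) (here refl)))
    (∈-map⁺ inColumn (∈-iterate-suc 2 e 2≤c (proj₂ rows-sorted)))
  Mixed-p false with below-d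
  ... | b , b∈row , 2≤b , b<d = subst (_∈ p) (dec-false (b ∈? firstColumn T) (proj₂ (row⁻ b∈row) ∘ column⊆))
    (∈-map⁺ inColumn (∈-iterate-suc 2 e 2≤b b<d))

  select : Bool → List ℕ → List ℕ
  select b = filter (λ i → inColumn i Bool.≟ b)

  length-p : length p ≡ e
  length-p = trans (length-map inColumn (iterate suc 2 e)) (length-iterate suc 2 e)

  state-positions : ∀ b → statePositions b (p , s) ≡ select b (iterate suc 2 e ++ iterate suc (3 + e) (N ∸ suc e))
  state-positions b = trans
    (cong₂ _++_ (positions-map b inColumn 2 e)
      (trans (cong (λ l → positions b (3 + l) s) length-p) (positions-map b inColumn (3 + e) (N ∸ suc e))))
    (sym (filter-++ (λ i → inColumn i Bool.≟ b) (iterate suc 2 e) _))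

  others : List ℕ
  others = iterate suc 2 e ++ iterate suc (3 + e) (N ∸ suc e)

  end : 3 + e + (N ∸ suc e) ≡ suc n
  end = cong (2 +_) (m+[n∸m]≡n (≤-pred d≤n))

  others-sorted : AllPairs _<_ others
  others-sorted = AllPairs.++⁺ (iterate-suc-< 2 e) (iterate-suc-< (3 + e) (N ∸ suc e))
    (All.map (λ (_ , u) → All.map (λ (l , _) → <-trans u l) (iterate-suc-bounds (3 + e) (N ∸ suc e))) (iterate-suc-bounds 2 e))

  others⁻ : ∀ {i} → i ∈ others → (2 ≤ i × i ≤ n) × i ≢ d
  others⁻ {i} h with ∈-++⁻ (iterate suc 2 e) h
  ... | inj₁ k with All.lookup (iterate-suc-bounds 2 e) k
  ...   | l , u = (l , <⇒≤ (≤-trans u d≤n)) , <⇒≢ u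
  others⁻ {i} h | inj₂ k with All.lookup (iterate-suc-bounds (3 + e) (N ∸ suc e)) k
  ...   | l , u = (≤-trans (m≤m+n 2 (suc e)) l , ≤-pred (≤-trans u (≤-reflexive end))) , <⇒≢ l ∘ sym

  others⁺ : ∀ {i} → 2 ≤ i → i ≤ n → i ≢ d → i ∈ others
  others⁺ {i} l u i≢d with i <? d
  ... | yes i<d = ∈-++⁺ˡ (∈-iterate-suc 2 e l i<d)
  ... | no  i≮d = ∈-++⁺ʳ (iterate suc 2 e)
    (∈-iterate-suc (3 + e) (N ∸ suc e) (≤∧≢⇒< (≮⇒≥ i≮d) (i≢d ∘ sym)) (≤-trans (s≤s u) (≤-reflexive (sym end))))

  column≡ : select true others ≡ c ∷ cs
  column≡ = sorted-≡ (AllPairs.filter⁺ _ others-sorted) column-sorted to from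
    where
    to : ∀ {i} → i ∈ select true others → i ∈ c ∷ cs
    to {i} h = subst (i ∈_) firstColumn≡ (inColumn-true (proj₂ (∈-filter⁻ (λ i → inColumn i Bool.≟ true) {xs = others} h)))
    from : ∀ {i} → i ∈ c ∷ cs → i ∈ select true others
    from {i} h = ∈-filter⁺ (λ i → inColumn i Bool.≟ true)
      (others⁺ (proj₁ (column-range k)) (proj₂ (column-range k)) λ { refl → d∉ k }) (dec-true (i ∈? firstColumn T) k)
      where
      k : i ∈ firstColumn T
      k = subst (i ∈_) (sym firstColumn≡) h

  row≡ : 1 ∷ select false others ≡ row
  row≡ = sorted-≡
    (All.tabulate (λ h → proj₁ (proj₁ (others⁻ (proj₁ (∈-filter⁻ (λ i → inColumn i Bool.≟ false) {xs = others} h)))))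
      ∷ AllPairs.filter⁺ _ others-sorted)
    (proj₁ rows-sorted) to from
    where
    entries≥2 : ∀ {i} → i ∈ entries T → 2 ≤ i
    entries≥2 h with ∈-entries⁻ h
    ... | inj₁ refl = s≤s (s≤s z≤n)
    ... | inj₂ k    = proj₁ (column-range k)
    to : ∀ {i} → i ∈ 1 ∷ select false others → i ∈ row
    to (here refl) = ∈-filter⁺ (_∉? entries T) (∈-[1⋯]⁺ ≤-refl (s≤s z≤n)) (λ h → <⇒≱ (entries≥2 h) ≤-refl)
    to (there h) with ∈-filter⁻ (λ i → inColumn i Bool.≟ false) {xs = others} h
    ... | k , eq with others⁻ k
    ...   | (l , u) , i≢d = ∈-filter⁺ (_∉? entries T) (∈-[1⋯]⁺ (<⇒≤ l) u) λ j → inColumn-false eq (entries⊆ j i≢d)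
    from : ∀ {i} → i ∈ row → i ∈ 1 ∷ select false others
    from {i} h with row⁻ h
    ... | (l , u) , ∉ with m≤n⇒m<n∨m≡n l
    ...   | inj₂ refl = here refl
    ...   | inj₁ 2≤i  = there (∈-filter⁺ (λ i → inColumn i Bool.≟ false)
      (others⁺ 2≤i u λ { refl → ∉ d∈ }) (dec-false (i ∈? firstColumn T) (∉ ∘ column⊆)))

  tableau≡ : tableau (p , s) ≡ T [ n ]
  tableau≡ = cong₂ _∷_
    (trans (cong (1 ∷_) (state-positions false)) row≡)
    (trans (cong₂ lower (trans (state-positions true) column≡) (cong (2 +_) length-p)) (sym T≡))

  -- Started at `d`, the circle runs through `d` to `n` and then 2 to `d - 1`. Without `d` itself
  -- these are the positions of `s` and of `p`.
  word≡ : map inColumn (iterate succ (succ d) (N ∸ 1)) ≡ s ++ p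
  word≡ = trans (cong (map inColumn) (tail≡ N (N ∸ e) (+-∸-assoc 1 (≤-pred d≤n)) (circle-split e d≤n)))
    (map-++ inColumn (iterate suc (3 + e) (N ∸ suc e)) _)
    where
    tail≡ : ∀ M M′ {ys} → M′ ≡ suc (N ∸ suc e) → iterate succ d M ≡ iterate suc d M′ ++ ys →
            iterate succ (succ d) (M ∸ 1) ≡ iterate suc (3 + e) (N ∸ suc e) ++ ys
    tail≡ (suc M) _ refl eq = ∷-injectiveʳ eq
    tail≡ zero    _ refl ()

  2≤N : 2 ≤ N
  2≤N with below-d
  ... | b , _ , 2≤b , b<d = ≤-pred (≤-trans (s≤s 2≤b) (≤-trans b<d d≤n))

  period : ∃ λ M → suc M ≡ suc (2 * (r ∸ 1)) * N × fold (T [ n ]) promotion M ≡ T [ n ]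
  period with HasRuns⇒Blocks {N} hasRuns d-range entries⊆ column⊆ d∈ d∉ unique
  ... | x , u , a , eq , B with Blocks-period B a
  ...   | M , count , v⟶v = M , trans count (cong (suc (2 * (r ∸ 1)) *_) suc-length) ,
    trans (cong (λ X → fold X promotion M) (sym tableau≡))
      (trans (proj₁ (fold-promotion Mixed-p M)) (trans (cong tableau ps⟶ps) tableau≡))
    where
    v = u ++ x ∷ replicate (suc a) (not x)
    v≡ : v ≡ s ++ p
    v≡ = trans (sym eq) word≡
    suc-length : suc (length v) ≡ N
    suc-length = trans (cong (suc ∘ length) (sym eq))
      (trans (cong suc (trans (length-map inColumn (iterate succ (succ d) (N ∸ 1))) (length-iterate succ (succ d) (N ∸ 1))))
             (m+[n∸m]≡n (≤-trans (s≤s z≤n) 2≤N)))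
    -- The tableau is met `length s` promotions after the state `(v , [])`, so a period of that
    -- state is also one of the tableau.
    v⟶ps : (v , []) ⟶[ length s ] (p , s)
    v⟶ps = trans (cong (λ w → fold (w , []) step (length s)) v≡) (⟶-turn s [] Mixed-p)
    ps⟶ps : (p , s) ⟶[ M ] (p , s)
    ps⟶ps = begin
      fold (p , s) step M                          ≡⟨ cong (λ X → fold X step M) v⟶ps ⟨
      fold (fold (v , []) step (length s)) step M  ≡⟨ fold-+ (v , []) step M ⟨
      fold (v , []) step (M + length s)            ≡⟨ cong (fold (v , []) step) (+-comm M (length s)) ⟩
      fold (v , []) step (length s + M)            ≡⟨ fold-+ (v , []) step (length s) ⟩
      fold (fold (v , []) step M) step (length s)  ≡⟨ cong (λ X → fold X step (length s)) v⟶v ⟩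
      fold (v , []) step (length s)                ≡⟨ v⟶ps ⟩
      (p , s) ∎

-- With `r = suc r′` and `n = suc N` this is (2r - 1)(n - 1) - 1 = (2r - 1)n - 2r; going through
-- `suc M` shows that the subtraction of `2r` does not truncate.
period-formula : ∀ r′ N M → suc M ≡ suc (2 * r′) * N → (2 * suc r′ ∸ 1) * suc N ∸ 2 * suc r′ ≡ M
period-formula r′ N M eq = trans (cong₂ (λ x y → (x ∸ 1) * suc N ∸ y) (double r′) (double r′))
  (trans (cong (_∸ (2 + 2 * r′)) (trans (*-suc (suc (2 * r′)) N) (trans (cong (suc (2 * r′) +_) (sym eq)) (+-suc (suc (2 * r′)) M))))
         (m+n∸m≡n (2 + 2 * r′) M))
  where
  double : ∀ r′ → 2 * suc r′ ≡ 2 + 2 * r′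
  double = solve-∀

top-right-bounds : ∀ {n c d cs} → IsStandard n (lower (c ∷ cs) d [ n ]) → 2 ≤ d × d ≤ n
top-right-bounds {n} {c} {d} {cs} standard with IsStandard.rows-increasing standard
... | _ ∷ (c<d ∷ _) ∷ _ =
  ≤-trans (s≤s (proj₁ (range (here refl)))) c<d , proj₂ (range (there (here refl)))
  where
  T = lower (c ∷ cs) d
  range : ∀ {i} → i ∈ entries T → 1 ≤ i × i ≤ n
  range h = ∈-[1⋯]⁻ (↭.∈-resp-↭ (IsStandard.entries-1⋯n standard) (∈-++⁺ʳ (filter (_∉? entries T) [1⋯ n ]) h))

near-hook-period : ∀ n r T → InNearHookClass n (suc r) T →
  ∃ λ M → 1 ≤ M × M ≡ (2 * suc r ∸ 1) * n ∸ 2 * suc r × fold (T [ n ]) promotion M ≡ T [ n ]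
near-hook-period n r T H with near-hook-shape (InNearHookClass.nearHook H)
... | c , d , cs , refl = go n d standard (InNearHookClass.hasRuns H) (top-right-bounds {cs = cs} standard)
  where
  standard = IsNearHook.standard (InNearHookClass.nearHook H)
  Period : ℕ → Tableau → Set
  Period n T = ∃ λ M → 1 ≤ M × M ≡ (2 * suc r ∸ 1) * n ∸ 2 * suc r × fold (T [ n ]) promotion M ≡ T [ n ]
  go : ∀ n d → IsStandard n (lower (c ∷ cs) d [ n ]) → HasRuns n (suc r) (lower (c ∷ cs) d) →
    2 ≤ d × d ≤ n → Period n (lower (c ∷ cs) d)
  go (suc N) (suc (suc e)) standard hasRuns _ =
    -- `suc M` is a positive multiple of `N`, and `N` is at least 2, so `M` is positive.
    M , ≤-pred (≤-trans 2≤N (≤-trans (m≤m+n N _) (≤-reflexive (sym (proj₁ (proj₂ period)))))) ,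
    sym (period-formula r N M (proj₁ (proj₂ period))) , proj₂ (proj₂ period)
    where
    open NearHook refl standard (suc r) hasRuns
    M = proj₁ period
  go zero    (suc (suc e)) _ _ (_ , ())
  go _       (suc zero)    _ _ (s≤s () , _)

theorem6p4 : (n r : ℕ) (T : Tableau) → 1 ≤ r → InNearHookClass n r T →
    ∃ λ t → IsPromotionPeriod (T [ n ]) t × t ∣ ((2 * r ∸ 1) * n ∸ 2 * r)
theorem6p4 n (suc r) T _ H with near-hook-period n r T H
... | M , 1≤M , refl , fixed with period-divides (≡-dec (≡-dec _≟_)) promotion (T [ n ]) 1≤M fixed
...   | t , (positive , fixes , least) , t∣M =
  t , record { positive = positive ; fixes = fixes ; least = least } , t∣M
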